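{- $\mathrm{Rot}_z(n) \in \Theta(\log n)$ as $n \to \infty$; that is, the multiplicative sensitivity of the number of Lempel--Ziv phrases to cyclic rotation is $\Theta(\log n)$.
   Context: Strings are indexed from $0$: a string $S$ of length $n=|S|$ is $S[0]\cdots S[n-1]$, and $S[i..j]$ is the substring from position $i$ to position $j$. A factorization of $S$ is a sequence of nonempty strings (phrases) $F_1,\dots,F_m$ with $S=F_1\cdots F_m$; the starting position of $F_i$ is $b_i=\sum_{k=1}^{i-1}|F_k|$. The Lempel--Ziv (LZ) factorization of $S$ is built from left to right: if the character $S[b_i]$ has no occurrence in $S$ starting before $b_i$, then $F_i=S[b_i]$; otherwise $F_i$ is the longest prefix of $S[b_i..n-1]$ that has an occurrence in $S$ starting before $b_i$ (this earlier occurrence may overlap $F_i$). The number of phrases is denoted $z(S)$. The sensitivity to cyclic rotation is $\mathrm{Rot}_z(n)=\max\{ z(TS)/z(ST) : S,T \in\Sigma^*,\ |ST|=n\}$, where $S,T$ range over all (possibly empty) strings over an alphabet $\Sigma$ of unrestricted size (i.e. strings over arbitrary alphabets; the number of distinct characters may grow with $n$). -}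

module Defs where

open import Data.Empty using (⊥-elim)
open import Data.Integer.Base using (+_)
open import Data.List.Base using (List; []; _∷_; [_]; _++_; concat; drop; length; take)
open import Data.List.Properties using (drop-drop; length-drop; length-take; take++drop≡id)
open import Data.List.Relation.Binary.Prefix.Heterogeneous using (Prefix; []; _∷_)
open import Data.List.Relation.Binary.Prefix.Heterogeneous.Properties using (length-mono; prefix?)
open import Data.Nat.Base using (ℕ; zero; suc; _+_; _≤_; _<_; NonZero; >-nonZero; s≤s; z≤n)
open import Data.Nat.Logarithm using (⌊log₂_⌋)
open import Data.Nat.Properties
  using (≤-refl; ≤-trans; ≤-pred; ≤-reflexive; m≤n⇒m<n∨m≡n; m≤n⇒m≤1+n; m≤n⇒m⊓n≡m; m∸n≤m; anyUpTo?)
open import Data.Product.Base using (∃; ∃₂; _×_; _,_; proj₁; proj₂)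
open import Data.Rational.Base as ℚ using (ℚ; _/_; 0ℚ)
open import Data.Sum.Base using (inj₁; inj₂)
open import Level using (Level)
open import Relation.Binary.Definitions using (DecidableEquality)
open import Relation.Binary.PropositionalEquality
  using (_≡_; refl; sym; trans; cong; subst; module ≡-Reasoning)
open import Relation.Nullary using (¬_; Dec; yes; no)

private
  variable
    ℓ : Level
    A : Set ℓ

infixr 5 _∷_
infix 4 _∈Θ_

OccursBefore : {A : Set ℓ} → ℕ → List A → List A → Set ℓ
OccursBefore b S P = ∃ λ i → i < b × Prefix _≡_ P (drop i S)

-- `drop b S` is S[b..n-1].
data IsPhrase {A : Set ℓ} (S : List A) (b : ℕ) : List A → Set ℓ where
  literal : ∀ {c W} → drop b S ≡ c ∷ W →
            ¬ OccursBefore b S [ c ] →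
            IsPhrase S b [ c ]
  copy    : ∀ {c W F} → drop b S ≡ c ∷ W →
            OccursBefore b S [ c ] →
            Prefix _≡_ F (drop b S) → OccursBefore b S F →
            (∀ G → Prefix _≡_ G (drop b S) → OccursBefore b S G → length G ≤ length F) →
            IsPhrase S b F

data ArePhrases {A : Set ℓ} (S : List A) : ℕ → List (List A) → Set ℓ where
  []  : ∀ {b} → ArePhrases S b []
  _∷_ : ∀ {b F Fs} → IsPhrase S b F → ArePhrases S (b + length F) Fs →
        ArePhrases S b (F ∷ Fs)

-- Phrases are automatically nonempty: the phrase of `copy` is at least as
-- long as the occurring prefix [ c ].
record IsLZFactorization {A : Set ℓ} (S : List A) (Fs : List (List A)) : Set ℓ where
  constructor mkLZ
  field
    factorizes : concat Fs ≡ S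
    phrases    : ArePhrases S 0 Fs

private
  prefix-take : ∀ k (W : List A) → Prefix _≡_ (take k W) W
  prefix-take zero    W       = []
  prefix-take (suc k) []      = []
  prefix-take (suc k) (x ∷ W) = refl ∷ prefix-take k W

  prefix⇒take : ∀ {G W : List A} → Prefix _≡_ G W → G ≡ take (length G) W
  prefix⇒take []         = refl
  prefix⇒take (refl ∷ p) = cong (_ ∷_) (prefix⇒take p)

  prefix⇒++ : ∀ {G W : List A} → Prefix _≡_ G W → G ++ drop (length G) W ≡ W
  prefix⇒++ []         = refl
  prefix⇒++ (refl ∷ p) = cong (_ ∷_) (prefix⇒++ p)

  greatest : (P : ℕ → Set ℓ) → (∀ k → Dec (P k)) → ∀ {m} n → m ≤ n → P m →
             ∃ λ k → m ≤ k × k ≤ n × P k × (∀ j → j ≤ n → P j → j ≤ k)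
  greatest P P? zero    z≤n Pm = 0 , z≤n , z≤n , Pm , λ _ j≤0 _ → j≤0
  greatest P P? (suc n) m≤n Pm with P? (suc n) | m≤n⇒m<n∨m≡n m≤n
  ... | yes Pn | _         = suc n , m≤n , ≤-refl , Pn , λ _ j≤n _ → j≤n
  ... | no ¬Pn | inj₂ refl = ⊥-elim (¬Pn Pm)
  ... | no ¬Pn | inj₁ m<n with greatest P P? n (≤-pred m<n) Pm
  ...   | k , m≤k , k≤n , Pk , max = k , m≤k , m≤n⇒m≤1+n k≤n , Pk , max′
    where
    max′ : ∀ j → j ≤ suc n → P j → j ≤ k
    max′ j j≤n Pj with m≤n⇒m<n∨m≡n j≤n
    ... | inj₁ j<n  = max j (≤-pred j<n) Pj
    ... | inj₂ refl = ⊥-elim (¬Pn Pj)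

module _ {A : Set ℓ} (_≟_ : DecidableEquality A) where

  private
    occursBefore? : ∀ b (S P : List A) → Dec (OccursBefore b S P)
    occursBefore? b S P = anyUpTo? (λ i → prefix? _≟_ P (drop i S)) b

    phrase : ∀ (S : List A) b {c W} → drop b S ≡ c ∷ W →
             ∃ λ F → 0 < length F × Prefix _≡_ F (drop b S) × IsPhrase S b F
    phrase S b {c} {W} eq with occursBefore? b S [ c ]
    ... | no ¬occ = [ c ] , s≤s z≤n , subst (Prefix _≡_ [ c ]) (sym eq) (refl ∷ []) , literal eq ¬occ
    ... | yes occ
      with greatest (λ k → OccursBefore b S (take k (c ∷ W)))
                    (λ k → occursBefore? b S (take k (c ∷ W)))
                    (length (c ∷ W)) (s≤s z≤n) occ
    ...   | k , 0<k , k≤n , Pk , max =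
      take k (c ∷ W) , subst (0 <_) (sym len) 0<k , pre , copy eq occ pre Pk longest
      where
      len : length (take k (c ∷ W)) ≡ k
      len = trans (length-take k (c ∷ W)) (m≤n⇒m⊓n≡m k≤n)
      pre : Prefix _≡_ (take k (c ∷ W)) (drop b S)
      pre = subst (Prefix _≡_ _) (sym eq) (prefix-take k (c ∷ W))
      longest : ∀ G → Prefix _≡_ G (drop b S) → OccursBefore b S G →
                length G ≤ length (take k (c ∷ W))
      longest G p o = subst (length G ≤_) (sym len)
        (max (length G) (length-mono p′) (subst (OccursBefore b S) (prefix⇒take p′) o))
        where
        p′ : Prefix _≡_ G (c ∷ W)
        p′ = subst (Prefix _≡_ G) eq p

    lzFrom : ∀ k (S : List A) b → length (drop b S) ≤ k →
             ∃ λ Fs → concat Fs ≡ drop b S × ArePhrases S b Fs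
    lzFrom k S b le with drop b S in eq
    lzFrom k       S b le       | []    = [] , refl , []
    lzFrom (suc k) S b (s≤s le) | c ∷ W with phrase S b eq
    ... | x ∷ F , _ , pre , isPh
      with lzFrom k S (b + length (x ∷ F)) (≤-trans (≤-reflexive (cong length (sym (drop-drop b _ S)))) shorter)
      where
      shorter : length (drop (length (x ∷ F)) (drop b S)) ≤ k
      shorter rewrite eq = ≤-trans (≤-reflexive (length-drop (length F) W))
                                   (≤-trans (m∸n≤m (length W) (length F)) le)
    ...   | Fs , cat , phs = (x ∷ F) ∷ Fs , whole , isPh ∷ phs
      where
      open ≡-Reasoning
      whole : (x ∷ F) ++ concat Fs ≡ c ∷ W
      whole = begin
        (x ∷ F) ++ concat Fs                                ≡⟨ cong ((x ∷ F) ++_) cat ⟩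
        (x ∷ F) ++ drop (b + length (x ∷ F)) S              ≡⟨ cong ((x ∷ F) ++_) (drop-drop b _ S) ⟨
        (x ∷ F) ++ drop (length (x ∷ F)) (drop b S)         ≡⟨ prefix⇒++ pre ⟩
        drop b S                                            ≡⟨ eq ⟩
        c ∷ W                                               ∎

  lz : (S : List A) → ∃ (IsLZFactorization S)
  lz S with lzFrom (length S) S 0 ≤-refl
  ... | Fs , cat , phs = Fs , mkLZ cat phs

  z : List A → ℕ
  z S = length (proj₁ (lz S))

  z-nonZero : (S : List A) → 0 < length S → NonZero (z S)
  z-nonZero S 0<n = >-nonZero (nonempty {proj₁ (lz S)} (IsLZFactorization.factorizes (proj₂ (lz S))) 0<n)
    where
    nonempty : ∀ {Fs} → concat Fs ≡ S → 0 < length S → 0 < length Fs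
    nonempty {[]}    refl ()
    nonempty {_ ∷ _} _    _  = s≤s z≤n

-- Requiring `z (S ++ T)` to be nonzero only excludes n = 0, by `z-nonZero`.
data RotationRatio (n : ℕ) : ℚ → Set₁ where
  ratio : {A : Set} (_≟_ : DecidableEquality A) (S T : List A) →
          length (S ++ T) ≡ n → .{{_ : NonZero (z _≟_ (S ++ T))}} →
          RotationRatio n (+ z _≟_ (T ++ S) / z _≟_ (S ++ T))

IsMax : (ℚ → Set₁) → ℚ → Set₁
IsMax P m = P m × (∀ q → P q → q ℚ.≤ m)

-- The maximum at n = 0 is over the empty set (0/0), so Rot 0 is unconstrained.
IsRot : (ℕ → ℚ) → Set₁
IsRot Rot = ∀ n → .{{NonZero n}} → IsMax (RotationRatio n) (Rot n)

_∈Θ_ : (ℕ → ℚ) → (ℕ → ℚ) → Set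
f ∈Θ g = ∃₂ λ c₁ c₂ → 0ℚ ℚ.< c₁ × 0ℚ ℚ.< c₂ ×
  (∃ λ N → ∀ n → N ≤ n → c₁ ℚ.* g n ℚ.≤ f n × f n ℚ.≤ c₂ ℚ.* g n)

-- ⌊log₂ n⌋ ≤ log₂ n ≤ 2 ⌊log₂ n⌋ for n ≥ 2, so neither the base nor the
-- rounding affects the class Θ(log n).
log : ℕ → ℚ
log n = + ⌊log₂ n ⌋ / 1

module Submission where

-- Call [a , b) a block of S if no phrase (of any parse of S) that starts at or
-- before a passes b. A parse has at least as many phrases as any chain of
-- blocks, and the LZ phrases are themselves blocks; so LZ parsing is optimal.
--
-- Upper bound. T S is a suffix of U = S T S, which is parsed into z (S T) + 1
-- phrases. Every LZ phrase of T S with length in [K , 2K), except at most one,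
-- accounts for K substrings of length 3K that are leftmost occurrences, hence
-- distinct. A leftmost occurrence in U is close to the end of a phrase of U, so
-- there are at most 3K (z (S T) + 1) such substrings, which bounds the number
-- of these phrases by O(z (S T)). There are O(log n) lengths K = 2 ^ k.
--
-- Lower bound. Start from M = 2 ^ K distinct letters V 0 and replace one letter
-- at a time, in bit reversal order of the positions, giving V 1 , V 2 , … .
-- S = V 0 V 1 ⋯ V (M - 1) has O(M) phrases, and T, a rearrangement of
-- V 1 , … , V (M - 1), adds only one phrase per word. T lists V t by decreasing
-- exponent of 2 in t. The letters of each dyadic window of length 2 ^ k are
-- replaced at times evenly spread over [0 , M), so the window differs between
-- any two multiples of 2 ^ (K - k). Hence for each of the 2 ^ (k - 1) odd
-- multiples t of 2 ^ (K - k), each of the 2 ^ (K - k) such windows of V t is new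
-- in T: these are K 2 ^ (K - 1) blocks in total.

open import Defs
open import Data.Empty using (⊥-elim)
import Data.Integer.Base as ℤ
import Data.Integer.Properties as ℤ
open import Data.List.Base using
  (List; []; _∷_; [_]; _++_; concat; drop; length; take; map; replicate; upTo; applyUpTo; downFrom;
   cartesianProductWith; cartesianProduct)
open import Data.List.Membership.Propositional using (_∈_; _∉_)
open import Data.List.Membership.Propositional.Properties
open import Data.List.Properties hiding (≡-dec)
open import Data.List.Relation.Binary.Prefix.Heterogeneous using (Prefix; []; _∷_)
open import Data.List.Relation.Unary.All as All using (All; []; _∷_)
import Data.List.Relation.Unary.All.Properties as All
open import Data.List.Relation.Unary.AllPairs as AllPairs using (AllPairs; []; _∷_)
import Data.List.Relation.Unary.AllPairs.Properties as AllPairs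
open import Data.List.Relation.Unary.Any using (here; there)
open import Data.List.Relation.Unary.Unique.Propositional using (Unique)
open import Data.Maybe.Base using (Maybe; just; nothing)
open import Data.Maybe.Properties using (just-injective)
open import Data.Nat.Base
open import Data.Nat.Induction using (<-rec)
open import Data.Nat.Logarithm
open import Data.Nat.Properties
open import Data.Nat.Tactic.RingSolver
open import Data.Product.Base using (∃; ∃₂; Σ-syntax; _×_; _,_; proj₁; proj₂)
open import Data.Product.Properties using (≡-dec)
open import Data.Rational.Base as ℚ using (ℚ; 0ℚ; toℚᵘ) renaming (_/_ to _÷_)
import Data.Rational.Properties as ℚ
open import Data.Rational.Unnormalised.Base as ℚᵘ using (mkℚᵘ)
import Data.Rational.Unnormalised.Properties as ℚᵘ
open import Data.Sum.Base using (_⊎_; inj₁; inj₂; [_,_]′)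
open import Function.Base using (const; id)
open import Relation.Binary.Bundles using (DecTotalOrder)
open import Relation.Binary.Definitions using (DecidableEquality)
open import Relation.Binary.PropositionalEquality hiding ([_])
open import Relation.Nullary using (¬_; yes; no)

open import Algebra.Properties.CommutativeSemigroup +-commutativeSemigroup using (x∙yz≈y∙xz)
open import Data.List.Extrema (DecTotalOrder.totalOrder ℚ.≤-decTotalOrder) using (argmax; argmax-all; f[xs]≤f[argmax])

private
  variable
    P Q : ℕ → ℕ → Set
    a b c k m w K : ℕ

-- Parses and blocks

data Chain (P : ℕ → ℕ → Set) : ℕ → ℕ → ℕ → Set where
  []  : ∀ {a} → Chain P a a 0
  _∷_ : ∀ {a b c m} → P a b → Chain P b c m → Chain P a c (suc m)

_◅◅_ : Chain P a b k → Chain P b c m → Chain P a c (k + m)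
[]       ◅◅ qs = qs
(p ∷ ps) ◅◅ qs = p ∷ (ps ◅◅ qs)

gmap : (f : ℕ → ℕ) → (∀ {a b} → P a b → Q (f a) (f b)) → Chain P a b m → Chain Q (f a) (f b) m
gmap f g []       = []
gmap f g (p ∷ ps) = g p ∷ gmap f g ps

module _ {A : Set} where

  -- A record, so that `S`, `i`, `j` and `l` can be inferred from a value; the bare equation does
  -- not determine them.
  record Agree (S : List A) (i j l : ℕ) : Set where
    constructor agrees
    field
      same : take l (drop i S) ≡ take l (drop j S)

  open Agree

  drop-length-++ : ∀ (P : List A) k Q → drop (length P + k) (P ++ Q) ≡ drop k Q
  drop-length-++ []      k Q = refl
  drop-length-++ (_ ∷ P) k Q = drop-length-++ P k Q

  take-length-++ : ∀ (Y Q : List A) → take (length Y) (Y ++ Q) ≡ Y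
  take-length-++ []      Q = refl
  take-length-++ (y ∷ Y) Q = cong (y ∷_) (take-length-++ Y Q)

  substring : ∀ {S} (P Y Q : List A) → S ≡ P ++ Y ++ Q → take (length Y) (drop (length P) S) ≡ Y
  substring P Y Q refl = trans
    (cong (take (length Y)) (subst (λ k → drop k (P ++ Y ++ Q) ≡ Y ++ Q) (+-identityʳ (length P)) (drop-length-++ P 0 (Y ++ Q))))
    (take-length-++ Y Q)

  -- Phrases of an arbitrary left-to-right parse, not necessarily the greedy
  -- one; the copied string may even be empty.
  data Step (S : List A) (b : ℕ) : ℕ → Set where
    literal : Step S b (suc b)
    copy    : ∀ {i l} → i < b → Agree S i b l → Step S b (b + l)

  Block : List A → ℕ → ℕ → Set
  Block S a b = a < b × (∀ {c d} → c ≤ a → Step S c d → d ≤ b)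

  Block⇒≤ : ∀ {S} → Chain (Block S) a b m → a ≤ b
  Block⇒≤ []               = ≤-refl
  Block⇒≤ ((a<b , _) ∷ bs) = ≤-trans (<⇒≤ a<b) (Block⇒≤ bs)

  -- The phrase of the parse that starts at or before the current block cannot
  -- pass it, so each phrase uses up at most one block.
  blocks≤steps : ∀ {S a b c d} → Chain (Block S) a b k → Chain (Step S) c d m →
                 c ≤ a → b ≤ d → k ≤ m
  blocks≤steps []               _        _   _   = z≤n
  blocks≤steps ((a<b , _) ∷ bs) []       c≤a b≤d =
    ⊥-elim (<-irrefl refl (≤-trans a<b (≤-trans (Block⇒≤ bs) (≤-trans b≤d c≤a))))
  blocks≤steps ((_ , stop) ∷ bs) (s ∷ ss) c≤a b≤d =
    s≤s (blocks≤steps bs ss (stop c≤a s) b≤d)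

  agree-sub : ∀ S {i j l} k {l′} → k + l′ ≤ l → Agree S i j l → Agree S (i + k) (j + k) l′
  agree-sub S {i} {j} {l} k {l′} le (agrees eq) =
    agrees (trans (sub i) (trans (cong (λ X → drop k (take (k + l′) X)) eq) (sym (sub j))))
    where
    open ≡-Reasoning
    sub : ∀ i → take l′ (drop (i + k) S) ≡ drop k (take (k + l′) (take l (drop i S)))
    sub i = begin
      take l′ (drop (i + k) S)                    ≡⟨ cong (take l′) (drop-drop i k S) ⟨
      take l′ (drop k (drop i S))                 ≡⟨ take-drop l′ k (drop i S) ⟩
      drop k (take (k + l′) (drop i S))           ≡⟨ cong (λ h → drop k (take h (drop i S))) (m≤n⇒m⊓n≡m le) ⟨
      drop k (take ((k + l′) ⊓ l) (drop i S))     ≡⟨ cong (drop k) (take-take (k + l′) l (drop i S)) ⟨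
      drop k (take (k + l′) (take l (drop i S)))  ∎

  -- The windows have lengths `l ⊓ (n ∸ i)` and `l ⊓ (n ∸ j)`; if the later one were cut off by the
  -- end of `S`, it would be strictly shorter.
  agree-within : ∀ S {i j l} → i < j → j ≤ length S → Agree S i j l → j + l ≤ length S
  agree-within S {i} {j} {l} i<j j≤n agree with l ≤? length S ∸ j
  ... | yes le = ≤-trans (+-monoʳ-≤ j le) (≤-reflexive (m+[n∸m]≡n j≤n))
  ... | no  gt = ⊥-elim (<-irrefl eq lt)
    where
    n = length S
    len : ∀ i → length (take l (drop i S)) ≡ l ⊓ (n ∸ i)
    len i = trans (length-take l (drop i S)) (cong (l ⊓_) (length-drop i S))
    eq : l ⊓ (n ∸ j) ≡ l ⊓ (n ∸ i)
    eq = trans (sym (len j)) (trans (cong length (sym (same agree))) (len i))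
    lt : l ⊓ (n ∸ j) < l ⊓ (n ∸ i)
    lt = subst (_< l ⊓ (n ∸ i)) (sym (m≥n⇒m⊓n≡n (<⇒≤ (≰⇒> gt))))
           (⊓-pres-m< (≰⇒> gt) (∸-monoʳ-< i<j j≤n))

  -- A copy that starts at `c ≤ b` and passes `b + l` contains the window of length `l + 1` at `b`;
  -- its source, shifted by `b - c`, is an earlier occurrence of that window. A literal starting at
  -- or before `b` stops by `b + 1`, hence `0 < l`.
  novel⇒block : ∀ S {b l} → 0 < l → (∀ {i} → i < b → ¬ Agree S i b (suc l)) → Block S b (b + l)
  novel⇒block S {b} {l} 0<l novel = m<m+n b 0<l , stop
    where
    stop : ∀ {c d} → c ≤ b → Step S c d → d ≤ b + l
    stop c≤b literal = ≤-trans (s≤s c≤b) (m<m+n b 0<l)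
    stop {c} c≤b (copy {i} {l′} i<c agree) with c + l′ ≤? b + l
    ... | yes le = le
    ... | no  gt = ⊥-elim (novel (subst (i + (b ∸ c) <_) (m+[n∸m]≡n c≤b) (+-monoˡ-< (b ∸ c) i<c))
                             (subst (λ h → Agree S (i + (b ∸ c)) h (suc l)) (m+[n∸m]≡n c≤b)
                               (agree-sub S (b ∸ c) fits agree)))
      where
      fits : (b ∸ c) + suc l ≤ l′
      fits = +-cancelˡ-≤ c _ _ (begin
        c + ((b ∸ c) + suc l) ≡⟨ +-assoc c (b ∸ c) (suc l) ⟨
        c + (b ∸ c) + suc l   ≡⟨ cong (_+ suc l) (m+[n∸m]≡n c≤b) ⟩
        b + suc l             ≡⟨ +-suc b l ⟩
        suc (b + l)           ≤⟨ ≰⇒> gt ⟩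
        c + l′                ∎)
        where open ≤-Reasoning

  prefix⇒take : ∀ {F X : List A} → Prefix _≡_ F X → take (length F) X ≡ F
  prefix⇒take []         = refl
  prefix⇒take (refl ∷ p) = cong (_ ∷_) (prefix⇒take p)

  take-prefix : ∀ l (X : List A) → Prefix _≡_ (take l X) X
  take-prefix zero    X       = []
  take-prefix (suc l) []      = []
  take-prefix (suc l) (x ∷ X) = refl ∷ take-prefix l X

  agree⇒occurs : ∀ S {i b l} → Agree S i b l → Prefix _≡_ (take l (drop b S)) (drop i S)
  agree⇒occurs S {i} {b} {l} (agrees eq) = subst (λ G → Prefix _≡_ G (drop i S)) eq (take-prefix l (drop i S))

  occurs⇒agree : ∀ S {i b F} → Prefix _≡_ F (drop i S) → Prefix _≡_ F (drop b S) → Agree S i b (length F)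
  occurs⇒agree S p q = agrees (trans (prefix⇒take p) (sym (prefix⇒take q)))

  prefix-drop-++ : ∀ i (S : List A) {F} X → Prefix _≡_ F (drop i S) → Prefix _≡_ F (drop i (S ++ X))
  prefix-drop-++ zero    _       X []      = []
  prefix-drop-++ zero    (_ ∷ S) X (e ∷ p) = e ∷ prefix-drop-++ zero S X p
  prefix-drop-++ (suc i) []      X []      = []
  prefix-drop-++ (suc i) (_ ∷ S) X p       = prefix-drop-++ i S X p

  -- A parse of `S` thus begins a parse of `S ++ X`: maximality may be lost, but every copy remains
  -- valid.
  phrase-step : ∀ {S b F} X → IsPhrase S b F → Step (S ++ X) b (b + length F)
  phrase-step {S} {b} X (literal _ _)               = subst (Step (S ++ X) b) (+-comm 1 b) literal
  phrase-step {S} {b} X (copy _ _ p (i , i<b , q) _) =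
    copy i<b (occurs⇒agree (S ++ X) (prefix-drop-++ i S X q) (prefix-drop-++ b S X p))

  drop≡∷⇒< : ∀ b (S : List A) {c W} → drop b S ≡ c ∷ W → b < length S
  drop≡∷⇒< zero    (x ∷ S) eq = s≤s z≤n
  drop≡∷⇒< (suc b) (x ∷ S) eq = s≤s (drop≡∷⇒< b S eq)

  -- Greedy maximality means that the window one letter longer has no earlier occurrence. By
  -- `agree-within` the longer window is not cut off, so it does contradict `longest`.
  phrase-block : ∀ {S b F} → IsPhrase S b F → Block S b (b + length F)
  phrase-block {S} {b} (literal {c} eq ¬occ) = novel⇒block S (s≤s z≤n) λ {i} i<b agree →
    ¬occ (i , i<b , subst (λ G → Prefix _≡_ G (drop i S)) (cong (take 1) eq)
      (agree⇒occurs S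
        (subst₂ (λ i b → Agree S i b 1) (+-identityʳ i) (+-identityʳ b) (agree-sub S 0 (s≤s z≤n) agree))))
  phrase-block {S} {b} (copy {c} {W} {F} eq occ _ _ longest) =
    novel⇒block S (longest [ c ] (subst (Prefix _≡_ [ c ]) (sym eq) (refl ∷ [])) occ) λ {i} i<b agree →
      let fits = agree-within S i<b (<⇒≤ (drop≡∷⇒< b S eq)) agree in
      <-irrefl refl (subst (_≤ length F) (len fits)
        (longest (take (suc (length F)) (drop b S)) (take-prefix _ (drop b S))
          (i , i<b , agree⇒occurs S agree)))
    where
    len : b + suc (length F) ≤ length S → length (take (suc (length F)) (drop b S)) ≡ suc (length F)
    len fits = trans (length-take _ (drop b S)) (m≤n⇒m⊓n≡m
      (subst (suc (length F) ≤_) (sym (length-drop b S))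
        (m+n≤o⇒m≤o∸n _ (subst (_≤ length S) (+-comm b _) fits))))

  phrase-chain : ∀ {S : List A} {P} → (∀ {b F} → IsPhrase S b F → P b (b + length F)) →
                 ∀ {b Fs} → ArePhrases S b Fs → Chain P b (b + length (concat Fs)) (length Fs)
  phrase-chain {P = P} f {b} []     = subst (λ e → Chain P b e 0) (sym (+-identityʳ b)) []
  phrase-chain {P = P} f {b} (_∷_ {F = F} {Fs} p ps) = f p ∷
    subst (λ e → Chain P (b + length F) e (length Fs))
      (trans (+-assoc b (length F) _) (cong (b +_) (sym (length-++ F)))) (phrase-chain f ps)

  module _ (_≟_ : DecidableEquality A) (S : List A) where

    private
      lz-chain : (∀ {b F} → IsPhrase S b F → P b (b + length F)) → Chain P 0 (length S) (z _≟_ S)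
      lz-chain {P} f = subst (λ e → Chain P 0 e (z _≟_ S)) (cong length factorizes) (phrase-chain f phrases)
        where open IsLZFactorization (proj₂ (lz _≟_ S))

    lz-steps : ∀ X → Chain (Step (S ++ X)) 0 (length S) (z _≟_ S)
    lz-steps X = lz-chain (phrase-step X)

    lz-parse : Chain (Step S) 0 (length S) (z _≟_ S)
    lz-parse = subst (λ X → Chain (Step X) 0 (length S) (z _≟_ S)) (++-identityʳ S) (lz-steps [])

    lz-blocks : Chain (Block S) 0 (length S) (z _≟_ S)
    lz-blocks = lz-chain phrase-block

-- The upper bound

ends : Chain P a c m → List ℕ
ends []                 = []
ends (_∷_ {b = b} _ ps) = b ∷ ends ps

length-ends : (ps : Chain P a c m) → length (ends ps) ≡ m
length-ends []       = refl
length-ends (_ ∷ ps) = cong suc (length-ends ps)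

link-around : (ps : Chain P a c m) → ∀ {q} → a ≤ q → q < c →
              ∃₂ λ b d → b ≤ q × q < d × P b d × d ∈ ends ps
link-around []                       a≤q q<c = ⊥-elim (<-irrefl refl (≤-<-trans a≤q q<c))
link-around (_∷_ {b = d} p ps) {q} a≤q q<c with d ≤? q
... | no  d≰q = _ , d , a≤q , ≰⇒> d≰q , p , here refl
... | yes d≤q with link-around ps d≤q q<c
...   | b , e , b≤q , q<e , p′ , e∈ = b , e , b≤q , q<e , p′ , there e∈

length-cartesianProductWith : ∀ {A B C : Set} (f : A → B → C) xs ys →
                              length (cartesianProductWith f xs ys) ≡ length xs * length ys
length-cartesianProductWith f []       ys = refl
length-cartesianProductWith f (x ∷ xs) ys = trans (length-++ (map (f x) ys))
  (cong₂ _+_ (length-map (f x) ys) (length-cartesianProductWith f xs ys))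

unique⇒length≤ : ∀ {A : Set} {xs ys : List A} → Unique xs → All (_∈ ys) xs → length xs ≤ length ys
unique⇒length≤ []           []           = z≤n
unique⇒length≤ {A} {x ∷ xs} (x≢ ∷ uniq) (x∈ys ∷ xs⊆) with ∈-∃++ x∈ys
... | us , vs , refl = ≤-trans
    (s≤s (unique⇒length≤ uniq (All.zipWith (λ (x≢y , y∈) → remove us y∈ x≢y) (x≢ , xs⊆))))
    (≤-reflexive (sym (length-++-sucʳ us x vs)))
  where
  remove : ∀ us {vs} {y : A} → y ∈ us ++ x ∷ vs → x ≢ y → y ∈ us ++ vs
  remove us y∈ x≢y with ∈-++⁻ us y∈
  ... | inj₁ y∈us         = ∈-++⁺ˡ y∈us
  ... | inj₂ (here refl)  = ⊥-elim (x≢y refl)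
  ... | inj₂ (there y∈vs) = ∈-++⁺ʳ us y∈vs

-- Counts are cumulative so that the sum over K = 1, 2, 4, ... telescopes: lengths in `[K , 2K)` are
-- counted by `short (K + K)` minus `short K`.
short : ℕ → Chain P a c m → ℕ
short K []                         = 0
short K (_∷_ {a = a} {b = b} _ ps) = [ const 1 , const 0 ]′ (<-≤-connex (b ∸ a) K) + short K ps

module _ {A : Set} where

  window : ℕ → List A → ℕ → List A
  window L X q = take L (drop q X)

  -- Offsets `o < L` give the windows that start before the end `e` and reach it. Entries where the
  -- subtraction truncates are harmless in an upper bound.
  windows-at : ℕ → List A → List ℕ → List (List A)
  windows-at L X es = cartesianProductWith (λ e o → window L X (e ∸ suc o)) es (upTo L)

  -- The leftmost occurrence of a window is not inside a copied phrase.
  window∈ : ∀ {X : List A} {L c} → 0 < L → (ss : Chain (Step X) 0 c m) →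
            ∀ {q} → q < c → window L X q ∈ windows-at L X (ends ss)
  window∈ {X = X} {L} {c} 0<L ss {q} = <-rec (λ q → q < c → window L X q ∈ windows-at L X (ends ss)) go q
    where
    go : ∀ q → (∀ {q′} → q′ < q → q′ < c → window L X q′ ∈ windows-at L X (ends ss)) →
         q < c → window L X q ∈ windows-at L X (ends ss)
    go q rec q<c with link-around ss z≤n q<c
    ... | b , d , b≤q , q<d , s , d∈ with d ≤? q + L
    ...   | yes d≤q+L = subst (λ q → window L X q ∈ windows-at L X (ends ss)) offset
              (∈-cartesianProductWith⁺ (λ e o → window L X (e ∸ suc o)) d∈ (∈-upTo⁺ o<L))
      where
      o = d ∸ suc q
      d≡ : suc q + o ≡ d
      d≡ = m+[n∸m]≡n q<d
      o<L : o < L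
      o<L = +-cancelˡ-≤ q _ _ (subst (_≤ q + L) (trans (sym d≡) (sym (+-suc q o))) d≤q+L)
      offset : d ∸ suc o ≡ q
      offset = trans (cong (_∸ suc o) (sym d≡)) (m+n∸n≡m q o)
    go q rec q<c | b , d , b≤q , q<d , literal , d∈ | no d≰q+L =
      ⊥-elim (d≰q+L (≤-trans (s≤s b≤q) (m<m+n q 0<L)))
    go q rec q<c | b , .(b + l) , b≤q , q<d , copy {i} {l} i<b agree , d∈ | no d≰q+L =
      subst (_∈ windows-at L X (ends ss)) (Agree.same shifted) (rec q′<q (<-trans q′<q q<c))
      where
      q′<q : i + (q ∸ b) < q
      q′<q = subst (i + (q ∸ b) <_) (m+[n∸m]≡n b≤q) (+-monoˡ-< (q ∸ b) i<b)
      fits : (q ∸ b) + L ≤ l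
      fits = +-cancelˡ-≤ b _ _ (subst (_≤ b + l)
        (trans (cong (_+ L) (sym (m+[n∸m]≡n b≤q))) (+-assoc b (q ∸ b) L)) (<⇒≤ (≰⇒> d≰q+L)))
      shifted : Agree X (i + (q ∸ b)) q L
      shifted = subst (λ h → Agree X (i + (q ∸ b)) h L) (m+[n∸m]≡n b≤q) (agree-sub X (q ∸ b) fits agree)

  module _ (W : List A) (K : ℕ) where

    -- A window starting less than `K` before a block shorter than `2K` passes the end of that
    -- block; hence `3K`.
    private L = K + K + K

    New : ℕ → Set
    New p = ∀ p′ → p′ < p → ¬ Agree W p′ p L

    -- A repetition of the window would be a copy from `p ≤ a` past `b`, which a block forbids.
    block⇒new : ∀ {p} → Block W a b → p ≤ a → b < p + L → New p
    block⇒new (_ , stop) p≤a b<p+L _ p′<p agree = <⇒≱ b<p+L (stop p≤a (copy p′<p agree))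

    -- `s` and `s′` stand for the numbers of blocks shorter than `K` and `2K`, so `many` grants `K`
    -- positions to each block in between. Two windows are distinct by `New` at the later position.
    -- The bound `p > a - K` in `range` keeps positions of successive blocks apart.
    record NewPositions (a c s s′ : ℕ) : Set where
      field
        ps    : List ℕ
        many  : s′ * K ≤ s * K + length ps
        apart : AllPairs (λ p p′ → p < p′ × New p′) ps
        range : All (λ p → suc a ≤ p + K × p < c × New p) ps

    -- A block of length in [K , 2K) starting at a contributes the K positions
    -- p in (a - K , a]: their windows of length 3K pass the end of the block.
    -- These ranges are disjoint for distinct such blocks.
    newPositions : K ≤ suc a → (bs : Chain (Block W) a c m) →
                   NewPositions a c (short K bs) (short (K + K) bs)
    newPositions K≤ [] = record { ps = [] ; many = z≤n ; apart = [] ; range = [] }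
    newPositions {a} {c} K≤ (_∷_ {b = b} bl bs) with <-≤-connex (b ∸ a) K | <-≤-connex (b ∸ a) (K + K)
    ... | inj₁ lt | inj₂ ge = ⊥-elim (<⇒≱ lt (≤-trans (m≤m+n K K) ge))
    ... | inj₁ _ | inj₁ _ = record
      { ps    = ps
      ; many  = ≤-trans (+-monoʳ-≤ K many) (≤-reflexive (sym (+-assoc K _ _)))
      ; apart = apart
      ; range = All.map (λ (r , p<c , new) → ≤-trans (s≤s (<⇒≤ (proj₁ bl))) r , p<c , new) range
      }
      where open NewPositions (newPositions (≤-trans K≤ (s≤s (<⇒≤ (proj₁ bl)))) bs)
    ... | inj₂ _ | inj₂ _ = record
      { ps    = ps
      ; many  = many
      ; apart = apart
      ; range = All.map (λ (r , p<c , new) → ≤-trans (s≤s (<⇒≤ (proj₁ bl))) r , p<c , new) range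
      }
      where open NewPositions (newPositions (≤-trans K≤ (s≤s (<⇒≤ (proj₁ bl)))) bs)
    ... | inj₂ K≤b-a | inj₁ b<2K = record
      { ps    = qs ++ ps
      ; many  = count
      ; apart = AllPairs.++⁺
          (AllPairs.applyUpTo⁺₁ (base +_) K λ i<j j<K → +-monoʳ-< base i<j , proj₂ (proj₂ (qs-ok j<K)))
          apart
          (All.applyUpTo⁺₁ (base +_) K λ j<K → All.map (λ (r , _ , new) → later j<K r , new) range)
      ; range = All.++⁺ (All.applyUpTo⁺₁ (base +_) K qs-ok)
          (All.map (λ (r , p<c , new) → ≤-trans (s≤s (<⇒≤ (proj₁ bl))) r , p<c , new) range)
      }
      where
      open NewPositions (newPositions (≤-trans K≤ (s≤s (<⇒≤ (proj₁ bl)))) bs)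
      -- Exact by `K ≤ suc a`: the `K` positions end at `a`.
      base = suc a ∸ K
      qs   = applyUpTo (base +_) K
      base+K : base + K ≡ suc a
      base+K = m∸n+n≡m K≤
      a<b = proj₁ bl
      a+K≤b : a + K ≤ b
      a+K≤b = subst (a + K ≤_) (m+[n∸m]≡n (<⇒≤ a<b)) (+-monoʳ-≤ a K≤b-a)
      b<a+2K : b < a + (K + K)
      b<a+2K = subst (_< a + (K + K)) (m+[n∸m]≡n (<⇒≤ a<b)) (+-monoʳ-< a b<2K)
      qs-ok : ∀ {j} → j < K → suc a ≤ base + j + K × base + j < c × New (base + j)
      qs-ok {j} j<K = lower , ≤-trans (s≤s upper) (≤-trans a<b (Block⇒≤ bs)) ,
                      block⇒new bl upper (≤-trans b<a+2K (begin
                        a + (K + K)          ≤⟨ +-monoˡ-≤ (K + K) (<⇒≤ lower) ⟩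
                        base + j + K + (K + K) ≡⟨ regroup (base + j) K ⟩
                        base + j + L         ∎))
        where
        open ≤-Reasoning
        regroup : ∀ p K → p + K + (K + K) ≡ p + (K + K + K)
        regroup = solve-∀
        upper : base + j ≤ a
        upper = ≤-pred (subst (base + j <_) base+K (+-monoʳ-< base j<K))
        lower : suc a ≤ base + j + K
        lower = subst (_≤ base + j + K) base+K (+-monoˡ-≤ K (m≤m+n base j))
      -- Since `b ≥ a + K`, positions beyond `b - K` are beyond `a`, where `qs` stops.
      later : ∀ {j p} → j < K → suc b ≤ p + K → base + j < p
      later {j} {p} j<K r = +-cancelʳ-≤ K _ _ (begin
        suc (base + j) + K ≡⟨ cong (_+ K) (+-suc base j) ⟨
        base + suc j + K   ≤⟨ +-monoˡ-≤ K (+-monoʳ-≤ base j<K) ⟩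
        base + K + K       ≡⟨ cong (_+ K) base+K ⟩
        suc a + K          ≤⟨ s≤s a+K≤b ⟩
        suc b              ≤⟨ r ⟩
        p + K              ∎)
        where open ≤-Reasoning
      count : K + short (K + K) bs * K ≤ short K bs * K + length (qs ++ ps)
      count = begin
        K + short (K + K) bs * K             ≤⟨ +-monoʳ-≤ K many ⟩
        K + (short K bs * K + length ps)     ≡⟨ x∙yz≈y∙xz K (short K bs * K) (length ps) ⟩
        short K bs * K + (K + length ps)     ≡⟨ cong (λ h → short K bs * K + (h + length ps)) (length-applyUpTo (base +_) K) ⟨
        short K bs * K + (length qs + length ps) ≡⟨ cong (short K bs * K +_) (length-++ qs) ⟨
        short K bs * K + length (qs ++ ps)   ∎
        where
        open ≤-Reasoning

    module _ (X : List A) (ss : Chain (Step (X ++ W)) 0 (length (X ++ W)) m) where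

      -- The windows at the collected positions are distinct, and `window∈` puts each into a list of
      -- `m * L` windows near the phrase ends of `X ++ W`.
      newPositions≤ : ∀ {s s′} → 0 < K → NewPositions a (length W) s s′ → s′ * K ≤ s * K + m * L
      newPositions≤ {s = s} 0<K np = ≤-trans many (+-monoʳ-≤ (s * K) (begin
        length ps                    ≡⟨ length-map (window L W) ps ⟨
        length (map (window L W) ps) ≤⟨ unique⇒length≤ distinct (All.map⁺ (All.map found range)) ⟩
        length (windows-at L (X ++ W) (ends ss)) ≡⟨ length-cartesianProductWith _ (ends ss) (upTo L) ⟩
        length (ends ss) * length (upTo L) ≡⟨ cong₂ _*_ (length-ends ss) (length-upTo L) ⟩
        m * L                        ∎))
        where
        open ≤-Reasoning
        open NewPositions np
        distinct : Unique (map (window L W) ps)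
        distinct = AllPairs.map⁺ (AllPairs.map (λ (p<p′ , new) eq → new _ p<p′ (agrees eq)) apart)
        found : ∀ {a p} → suc a ≤ p + K × p < length W × New p → window L W p ∈ windows-at L (X ++ W) (ends ss)
        found {p = p} (_ , p<n , _) = subst (_∈ windows-at L (X ++ W) (ends ss))
          (cong (take L) (drop-length-++ X p W))
          (window∈ (≤-trans 0<K (m≤n+m K (K + K))) ss
            (subst (length X + p <_) (sym (length-++ X)) (+-monoʳ-< (length X) p<n)))

      -- The extra `K` pays for at most one block: `newPositions` needs `K ≤ suc a`, which holds at
      -- every block after one of length at least `K`.
      doubling : 0 < K → (bs : Chain (Block W) a (length W) k) →
                 short (K + K) bs * K ≤ short K bs * K + (K + m * L)
      doubling 0<K [] = z≤n
      doubling {a = a} 0<K bs₀@(_∷_ {b = b} bl bs) with K ≤? suc a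
      ... | yes K≤ = ≤-trans (newPositions≤ 0<K (newPositions K≤ bs₀))
                       (+-monoʳ-≤ (short K bs₀ * K) (m≤n+m (m * L) K))
      ... | no _ with <-≤-connex (b ∸ a) K | <-≤-connex (b ∸ a) (K + K)
      ...   | inj₁ lt | inj₂ ge = ⊥-elim (<⇒≱ lt (≤-trans (m≤m+n K K) ge))
      ...   | inj₁ _ | inj₁ _ = ≤-trans (+-monoʳ-≤ K (doubling 0<K bs)) (≤-reflexive (sym (+-assoc K _ _)))
      ...   | inj₂ _ | inj₂ _ = doubling 0<K bs
      ...   | inj₂ K≤b-a | inj₁ _ = ≤-trans (+-monoʳ-≤ K (newPositions≤ 0<K (newPositions K≤ bs)))
                                  (≤-reflexive (x∙yz≈y∙xz K (short K bs * K) (m * L)))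
        where
        K≤ : K ≤ suc b
        K≤ = m≤n⇒m≤1+n (≤-trans K≤b-a (m∸n≤m b a))

  short-one : ∀ {W} (bs : Chain (Block {A} W) a c m) → short 1 bs ≡ 0
  short-one [] = refl
  short-one (_∷_ {a = a} {b} (a<b , _) bs) with <-≤-connex (b ∸ a) 1
  ... | inj₁ lt = ⊥-elim (<⇒≱ lt (m<n⇒0<n∸m a<b))
  ... | inj₂ _  = short-one bs

  short-all : ∀ {W K} (bs : Chain (Block {A} W) a c m) → c < K → short K bs ≡ m
  short-all []                           c<K = refl
  short-all {K = K} (_∷_ {a = a} {b} _ bs) c<K with <-≤-connex (b ∸ a) K
  ... | inj₁ _  = cong suc (short-all bs c<K)
  ... | inj₂ ge = ⊥-elim (≤⇒≯ ge (≤-<-trans (m∸n≤m b a) (≤-<-trans (Block⇒≤ bs) c<K)))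

  -- `doubling` divided by `K` says that at most `3m + 1` blocks have length in `[K , 2K)`. No block
  -- is shorter than 1, and all are shorter than the final `2 ^ h`.
  suffix-bound : ∀ (X W : List A) → Chain (Step (X ++ W)) 0 (length (X ++ W)) m →
                 Chain (Block W) 0 (length W) k → ∀ h → length W < 2 ^ h → k ≤ h * suc (m * 3)
  suffix-bound {m} {k} X W ss bs h n< = subst (_≤ h * suc (m * 3)) (short-all bs n<) (go h)
    where
    open ≤-Reasoning
    go : ∀ h → short (2 ^ h) bs ≤ h * suc (m * 3)
    go zero    = ≤-reflexive (short-one bs)
    go (suc h) = *-cancelʳ-≤ _ _ M (begin
      short (2 ^ suc h) bs * M                 ≡⟨ cong (λ M′ → short (M + M′) bs * M) (+-identityʳ M) ⟩
      short (M + M) bs * M                     ≤⟨ doubling W M X ss (m^n>0 2 h) bs ⟩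
      short M bs * M + (M + m * (M + M + M))   ≡⟨ regroup (short M bs) M m ⟩
      (suc (m * 3) + short M bs) * M           ≤⟨ *-monoˡ-≤ M (+-monoʳ-≤ (suc (m * 3)) (go h)) ⟩
      (suc (m * 3) + h * suc (m * 3)) * M      ∎)
      where
      M = 2 ^ h
      instance
        _ = m^n≢0 2 h
      regroup : ∀ s K m → s * K + (K + m * (K + K + K)) ≡ (suc (m * 3) + s) * K
      regroup = solve-∀

  rotation-upper : ∀ (_≟_ : DecidableEquality A) (S T : List A) h → length (T ++ S) < 2 ^ h →
                   0 < length (S ++ T) →
                   z _≟_ (T ++ S) ≤ h * suc (suc (z _≟_ (S ++ T)) * 3)
  rotation-upper _≟_ S T h n< 0<n = suffix-bound S (T ++ S) parse (lz-blocks _≟_ (T ++ S)) h n<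
    where
    n = z _≟_ (S ++ T)
    -- The final `S` of `S T S` is a single copy from position 0.
    again : Agree ((S ++ T) ++ S) 0 (length (S ++ T)) (length S)
    again = agrees (trans (substring [] S (T ++ S) (++-assoc S T S))
                     (sym (substring (S ++ T) S [] (cong ((S ++ T) ++_) (sym (++-identityʳ S))))))
    parse : Chain (Step (S ++ T ++ S)) 0 (length (S ++ T ++ S)) (suc n)
    parse = subst (λ U → Chain (Step U) 0 (length U) (suc n)) (++-assoc S T S)
      (subst₂ (λ e j → Chain (Step ((S ++ T) ++ S)) 0 e j) (sym (length-++ (S ++ T))) (+-comm n 1)
        (lz-steps _≟_ (S ++ T) S ◅◅ (copy 0<n again ∷ [])))

-- The lower bound

module _ {A : Set} where

  -- The continuation `Q` is arbitrary because the string that a step refers to keeps growing while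
  -- phrases are appended.
  Built : List A → ℕ → Set
  Built P m = ∀ Q → Chain (Step (P ++ Q)) 0 (length P) m

  built-[] : Built [] 0
  built-[] Q = []

  built-++ : ∀ {P} Y → Built P m → (∀ Q → Step (P ++ Y ++ Q) (length P) (length P + length Y)) →
             Built (P ++ Y) (suc m)
  built-++ {m} {P} Y built step Q = subst (λ U → Chain (Step U) 0 (length (P ++ Y)) (suc m)) (sym (++-assoc P Y Q))
    (subst₂ (λ e j → Chain (Step (P ++ Y ++ Q)) 0 e j) (sym (length-++ P)) (+-comm m 1)
      (built (Y ++ Q) ◅◅ (step Q ∷ [])))

  built-literal : ∀ {P} c → Built P m → Built (P ++ [ c ]) (suc m)
  built-literal {P = P} c built = built-++ [ c ] built λ Q →
    subst (Step (P ++ [ c ] ++ Q) (length P)) (+-comm 1 (length P)) literal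

  built-literals : ∀ {P} Y → Built P m → Built (P ++ Y) (length Y + m)
  built-literals {m} {P} []      built = subst (λ U → Built U m) (sym (++-identityʳ P)) built
  built-literals {m} {P} (c ∷ Y) built = subst₂ Built (++-assoc P [ c ] Y) (+-suc (length Y) m)
    (built-literals Y (built-literal c built))

  built-copy : ∀ {P} u Y v → P ≡ u ++ Y ++ v → length u < length P → Built P m → Built (P ++ Y) (suc m)
  built-copy {P = P} u Y v eq u<P built = built-++ Y built λ Q →
    copy u<P (agrees (trans (substring u Y (v ++ Y ++ Q) (earlier Q)) (sym (substring P Y Q refl))))
    where
    earlier : ∀ Q → P ++ Y ++ Q ≡ u ++ Y ++ v ++ Y ++ Q
    earlier Q = trans (cong (_++ Y ++ Q) eq)
      (trans (++-assoc u (Y ++ v) (Y ++ Q)) (cong (u ++_) (++-assoc Y v (Y ++ Q))))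

  -- One literal and one copy from position 0 that may overlap itself, so padding of any length
  -- costs two phrases.
  built-replicate : ∀ r (c : A) → Built (replicate (suc r) c) 2
  built-replicate r c = built-++ (replicate r c) (built-literal c built-[]) λ Q →
    copy (s≤s z≤n) (agrees (trans (shifted r Q) (sym (take-length-++ (replicate r c) Q))))
    where
    shifted : ∀ r Q → take (length (replicate r c)) (replicate (suc r) c ++ Q) ≡ replicate r c
    shifted zero    Q = refl
    shifted (suc r) Q = cong (c ∷_) (shifted r Q)

  -- Copy `u`, write `c′`, copy `v`: three phrases.
  built-replace : ∀ X u {c} c′ v → Built (X ++ u ++ c ∷ v) m →
                  Built ((X ++ u ++ c ∷ v) ++ u ++ c′ ∷ v) (3 + m)
  built-replace {m} X u {c} c′ v built =
    subst (λ U → Built U (3 + m)) (trans (++-assoc (W ++ u) [ c′ ] v) (++-assoc W u (c′ ∷ v)))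
      (built-copy (X ++ u ++ [ c ]) v (u ++ [ c′ ]) split
        (subst (length (X ++ u ++ [ c ]) <_) (sym (trans (length-++ (W ++ u)) (+-comm (length (W ++ u)) 1))) (s≤s shorter))
        (built-literal c′ (built-copy X u (c ∷ v) refl X<W built)))
    where
    W = X ++ u ++ c ∷ v
    assoc : W ≡ (X ++ u ++ [ c ]) ++ v
    assoc = trans (cong (X ++_) (sym (++-assoc u [ c ] v))) (sym (++-assoc X (u ++ [ c ]) v))
    split : (W ++ u) ++ [ c′ ] ≡ (X ++ u ++ [ c ]) ++ v ++ u ++ [ c′ ]
    split = trans (++-assoc W u [ c′ ]) (trans (cong (_++ u ++ [ c′ ]) assoc) (++-assoc (X ++ u ++ [ c ]) v (u ++ [ c′ ])))
    X<W : length X < length W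
    X<W = subst (length X <_) (sym (length-++ X)) (m<m+n (length X)
      (subst (0 <_) (sym (length-++ u)) (m≤n⇒m≤o+n (length u) (s≤s z≤n))))
    shorter : length (X ++ u ++ [ c ]) ≤ length (W ++ u)
    shorter = subst (length (X ++ u ++ [ c ]) ≤_) (sym (trans (length-++ W) (cong (_+ length u)
      (trans (cong length assoc) (length-++ (X ++ u ++ [ c ])))))) (≤-trans (m≤m+n _ (length v)) (m≤m+n _ (length u)))

-- Letter y of V K x t is (x + y , number of times it has been replaced): as t
-- grows to t + 1 exactly one letter is replaced, and the replacements follow
-- the bit reversal order, so that they are evenly distributed over time in
-- each dyadic window.
V : ℕ → ℕ → ℕ → List (ℕ × ℕ)
V zero    x t = [ (x , t) ]
V (suc K) x t = V K x ⌈ t /2⌉ ++ V K (2 ^ K + x) ⌊ t /2⌋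

length-V : ∀ K x t → length (V K x t) ≡ 2 ^ K
length-V zero    x t = refl
length-V (suc K) x t = trans (length-++ (V K x ⌈ t /2⌉))
  (cong₂ _+_ (length-V K x _) (trans (length-V K _ _) (sym (+-identityʳ (2 ^ K)))))

⌈n/2⌉≡⌊n/2⌋⊎suc : ∀ n → ⌈ n /2⌉ ≡ ⌊ n /2⌋ ⊎ ⌈ n /2⌉ ≡ suc ⌊ n /2⌋
⌈n/2⌉≡⌊n/2⌋⊎suc zero          = inj₁ refl
⌈n/2⌉≡⌊n/2⌋⊎suc (suc zero)    = inj₂ refl
⌈n/2⌉≡⌊n/2⌋⊎suc (suc (suc n)) with ⌈n/2⌉≡⌊n/2⌋⊎suc n
... | inj₁ eq = inj₁ (cong suc eq)
... | inj₂ eq = inj₂ (cong suc eq)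

record Replaced (X Y : List (ℕ × ℕ)) : Set where
  constructor replaced
  field
    {before after} : List (ℕ × ℕ)
    {old new}      : ℕ × ℕ
    X≡ : X ≡ before ++ old ∷ after
    Y≡ : Y ≡ before ++ new ∷ after

-- If `t` is even, the step to `t + 1` raises `⌈ t /2⌉` and keeps `⌊ t /2⌋`; if `t` is odd,
-- conversely. So just one half changes, and induction applies to it.
V-replaced : ∀ K x t → Replaced (V K x t) (V K x (suc t))
V-replaced zero    x t = replaced {before = []} refl refl
V-replaced (suc K) x t with ⌈n/2⌉≡⌊n/2⌋⊎suc t
... | inj₁ eq rewrite eq with V-replaced K x ⌊ t /2⌋
...   | replaced {u} {v} X≡ Y≡ = replaced
  (trans (cong (_++ V K (2 ^ K + x) ⌊ t /2⌋) X≡) (++-assoc u _ _))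
  (trans (cong (_++ V K (2 ^ K + x) ⌊ t /2⌋) Y≡) (++-assoc u _ _))
V-replaced (suc K) x t | inj₂ eq rewrite eq with V-replaced K (2 ^ K + x) ⌊ t /2⌋
...   | replaced {u} {v} X≡ Y≡ = replaced
  (trans (cong (V K x (suc ⌊ t /2⌋) ++_) X≡) (sym (++-assoc (V K x (suc ⌊ t /2⌋)) u _)))
  (trans (cong (V K x (suc ⌊ t /2⌋) ++_) Y≡) (sym (++-assoc (V K x (suc ⌊ t /2⌋)) u _)))

dbl : ℕ → ℕ
dbl a = a + a

V-dbl : ∀ K x a → V (suc K) x (dbl a) ≡ V K x a ++ V K (2 ^ K + x) a
V-dbl K x a = cong₂ (λ h l → V K x h ++ V K (2 ^ K + x) l) (sym (n≡⌈n+n/2⌉ a)) (sym (n≡⌊n+n/2⌋ a))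

drop-2^-++ : ∀ K x t k Z → drop (2 ^ K + k) (V K x t ++ Z) ≡ drop k Z
drop-2^-++ K x t k Z = subst (λ l → drop (l + k) (V K x t ++ Z) ≡ drop k Z) (length-V K x t) (drop-length-++ (V K x t) k Z)

take-2^-++ : ∀ K x t Z → take (2 ^ K) (V K x t ++ Z) ≡ V K x t
take-2^-++ K x t Z = subst (λ l → take l (V K x t ++ Z) ≡ V K x t) (length-V K x t) (take-length-++ (V K x t) Z)

-- The halves of the word determine `⌈ t /2⌉` and `⌊ t /2⌋`, which add up to `t`.
V-injective : ∀ K x {t t′} → V K x t ≡ V K x t′ → t ≡ t′
V-injective zero    x refl = refl
V-injective (suc K) x {t} {t′} eq = begin
  t                        ≡⟨ ⌊n/2⌋+⌈n/2⌉≡n t ⟨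
  ⌊ t /2⌋ + ⌈ t /2⌉        ≡⟨ cong₂ _+_ (V-injective K _ right) (V-injective K _ left) ⟩
  ⌊ t′ /2⌋ + ⌈ t′ /2⌉      ≡⟨ ⌊n/2⌋+⌈n/2⌉≡n t′ ⟩
  t′                       ∎
  where
  open ≡-Reasoning
  left : V K x ⌈ t /2⌉ ≡ V K x ⌈ t′ /2⌉
  left = trans (sym (take-2^-++ K x _ _)) (trans (cong (take (2 ^ K)) eq) (take-2^-++ K x _ _))
  right : V K (2 ^ K + x) ⌊ t /2⌋ ≡ V K (2 ^ K + x) ⌊ t′ /2⌋
  right = trans (sym (drop-2^-++ K x ⌈ t /2⌉ 0 _)) (trans (cong (drop (2 ^ K + 0)) eq) (drop-2^-++ K x ⌈ t′ /2⌉ 0 _))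

-- The first component of a letter reveals its position in the word, whatever `t` is, so equal
-- windows must start at equal offsets.
V-label : ∀ K x t Z {i} → i < 2 ^ K → ∃₂ λ v R → drop i (V K x t ++ Z) ≡ (x + i , v) ∷ R
V-label zero    x t Z {zero} _ = t , Z , cong (λ y → (y , t) ∷ Z) (sym (+-identityʳ x))
V-label zero    x t Z {suc i} (s≤s ())
V-label (suc K) x t Z {i} i< rewrite ++-assoc (V K x ⌈ t /2⌉) (V K (2 ^ K + x) ⌊ t /2⌋) Z
  with i <? 2 ^ K
... | yes lt = V-label K x ⌈ t /2⌉ _ lt
... | no  ge with m≤n⇒∃[o]m+o≡n (≮⇒≥ ge)
...   | j , refl with V-label K (2 ^ K + x) ⌊ t /2⌋ Z (subst (j <_) (+-identityʳ (2 ^ K)) (+-cancelˡ-< (2 ^ K) _ _ i<))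
...     | v , R , eq = v , R , trans (drop-2^-++ K x ⌈ t /2⌉ j _)
            (trans eq (cong (λ y → (y , v) ∷ R) (regroup (2 ^ K) x j)))
  where
  regroup : ∀ p x j → p + x + j ≡ x + (p + j)
  regroup = solve-∀

-- Occurrences at the same offset `y` are excluded here; `V-label` excludes the others. Arbitrary
-- `x` allows the use in either half of a larger word, arbitrary `Z′` and `Z` the use inside longer
-- strings.
record Differs (K : ℕ) (es : List ℕ) (t y y′ : ℕ) : Set where
  field
    l       : ℕ
    y′≡     : y′ ≡ y + l
    0<l     : 0 < l
    y′≤     : y + l ≤ 2 ^ K
    differs : ∀ {t′} → t′ ∈ es → ∀ x Z′ Z →
              take l (drop y (V K x t′ ++ Z′)) ≢ take l (drop y (V K x t ++ Z))

Tiled : ℕ → List ℕ → ℕ → ℕ → Set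
Tiled K es t m = Chain (Differs K es t) 0 (2 ^ K) m

tiled-whole : ∀ K {es t} → t ∉ es → Tiled K es t 1
tiled-whole K {es} {t} t∉ = record
  { l       = 2 ^ K
  ; y′≡     = refl
  ; 0<l     = m^n>0 2 K
  ; y′≤     = ≤-refl
  ; differs = λ {t′} t′∈ x Z′ Z eq → t∉ (subst (_∈ es)
      (V-injective K x (trans (sym (take-2^-++ K x t′ Z′)) (trans eq (take-2^-++ K x t Z)))) t′∈)
  } ∷ []

-- At an even time both halves are words at half that time, and likewise for the earlier even times,
-- so each half inherits the tiling of level `K`.
tiled-dbl : ∀ {es a} → Tiled K es a m → Tiled (suc K) (map dbl es) (dbl a) (m + m)
tiled-dbl {K} {m} {es} {a} tiled = gmap id left tiled ◅◅
  subst₂ (λ s e → Chain (Differs (suc K) (map dbl es) (dbl a)) s e m) (+-identityʳ (2 ^ K))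
    (cong (2 ^ K +_) (sym (+-identityʳ (2 ^ K)))) (gmap (2 ^ K +_) right tiled)
  where
  split : ∀ x t Z → V (suc K) x (dbl t) ++ Z ≡ V K x t ++ V K (2 ^ K + x) t ++ Z
  split x t Z = trans (cong (_++ Z) (V-dbl K x t)) (++-assoc (V K x t) _ Z)
  left : ∀ {y y′} → Differs K es a y y′ → Differs (suc K) (map dbl es) (dbl a) y y′
  left {y} d = record
    { l = l ; y′≡ = y′≡ ; 0<l = 0<l ; y′≤ = ≤-trans y′≤ (m≤m+n (2 ^ K) _)
    ; differs = diff }
    where
    open Differs d
    diff : ∀ {t′} → t′ ∈ map dbl es → ∀ x Z′ Z →
           take l (drop y (V (suc K) x t′ ++ Z′)) ≢ take l (drop y (V (suc K) x (dbl a) ++ Z))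
    diff t′∈ x Z′ Z eq with ∈-map⁻ dbl t′∈
    ... | b , b∈ , refl = differs b∈ x _ _
      (subst₂ (λ X Y → take l (drop y X) ≡ take l (drop y Y)) (split x b Z′) (split x a Z) eq)
  right : ∀ {y y′} → Differs K es a y y′ → Differs (suc K) (map dbl es) (dbl a) (2 ^ K + y) (2 ^ K + y′)
  right {y} d = record
    { l = l ; y′≡ = trans (cong (2 ^ K +_) y′≡) (sym (+-assoc (2 ^ K) y l)) ; 0<l = 0<l
    ; y′≤ = subst₂ _≤_ (sym (+-assoc (2 ^ K) y l)) (cong (2 ^ K +_) (sym (+-identityʳ (2 ^ K)))) (+-monoʳ-≤ (2 ^ K) y′≤)
    ; differs = diff }
    where
    open Differs d
    diff : ∀ {t′} → t′ ∈ map dbl es → ∀ x Z′ Z →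
           take l (drop (2 ^ K + y) (V (suc K) x t′ ++ Z′)) ≢ take l (drop (2 ^ K + y) (V (suc K) x (dbl a) ++ Z))
    diff t′∈ x Z′ Z eq with ∈-map⁻ dbl t′∈
    ... | b , b∈ , refl = differs b∈ (2 ^ K + x) Z′ Z
      (subst₂ (λ X Y → take l X ≡ take l Y)
        (trans (cong (drop (2 ^ K + y)) (split x b Z′)) (drop-2^-++ K x b y _))
        (trans (cong (drop (2 ^ K + y)) (split x a Z)) (drop-2^-++ K x a y _)) eq)

-- Lists of times have the latest entry of the string first.
data Fresh (K : ℕ) : List ℕ → ℕ → Set where
  []  : Fresh K [] 0
  _∷_ : ∀ {t ts} → Tiled K ts t m → Fresh K ts w → Fresh K (t ∷ ts) (m + w)

fresh-dbl : ∀ {ts} → Fresh K ts w → Fresh (suc K) (map dbl ts) (w + w)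
fresh-dbl [] = []
fresh-dbl {K} (_∷_ {m = m} {w} {t} {ts} tiled fresh) =
  subst (Fresh (suc K) (map dbl (t ∷ ts))) (regroup m w) (tiled-dbl tiled ∷ fresh-dbl fresh)
  where
  regroup : ∀ m w → m + m + (w + w) ≡ m + w + (m + w)
  regroup = solve-∀

-- Concatenated words and their blocks

catFrom : ℕ → List (ℕ × ℕ) → List ℕ → List (ℕ × ℕ)
catFrom K P []       = P
catFrom K P (t ∷ ts) = catFrom K P ts ++ V K 0 t

length-catFrom : ∀ K P ts → length (catFrom K P ts) ≡ length P + length ts * 2 ^ K
length-catFrom K P []       = sym (+-identityʳ (length P))
length-catFrom K P (t ∷ ts) = trans (length-++ (catFrom K P ts))
  (trans (cong₂ _+_ (length-catFrom K P ts) (length-V K 0 t)) (regroup (length P) (length ts) (2 ^ K)))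
  where
  regroup : ∀ p s M → p + s * M + M ≡ p + (M + s * M)
  regroup = solve-∀

catFrom-++ : ∀ K P ts → catFrom K P ts ≡ P ++ catFrom K [] ts
catFrom-++ K P []       = sym (++-identityʳ P)
catFrom-++ K P (t ∷ ts) = trans (cong (_++ V K 0 t) (catFrom-++ K P ts)) (++-assoc P _ _)

cat : ℕ → List ℕ → List (ℕ × ℕ)
cat K = catFrom K []

locate : ∀ K ts Z {i} → i < length (cat K ts) →
         ∃ λ t → ∃₂ λ j Z′ → t ∈ ts × j < 2 ^ K × drop i (cat K ts ++ Z) ≡ drop j (V K 0 t ++ Z′)
locate K (t ∷ ts) Z {i} i< with i <? length (cat K ts)
... | yes lt with locate K ts (V K 0 t ++ Z) lt
...   | t′ , j , Z′ , t′∈ , j< , eq = t′ , j , Z′ , there t′∈ , j< , trans (cong (drop i) (++-assoc (cat K ts) _ Z)) eq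
locate K (t ∷ ts) Z {i} i< | no ge with m≤n⇒∃[o]m+o≡n (≮⇒≥ ge)
... | j , refl = t , j , Z , here refl ,
  +-cancelˡ-< (length (cat K ts)) _ _
    (subst (length (cat K ts) + j <_) (trans (length-++ (cat K ts)) (cong (length (cat K ts) +_) (length-V K 0 t))) i<) ,
  trans (cong (drop (length (cat K ts) + j)) (++-assoc (cat K ts) _ Z)) (drop-length-++ (cat K ts) j _)

-- By the labels, an earlier occurrence starts at the same offset of its word, hence in an earlier
-- word, which `differs` forbids. Of the `l + 1` letters compared, the first fixes the offset and
-- the first `l` give the contradiction.
differs⇒block : ∀ {ts t y y′} Z → Differs K ts t y y′ →
                Block (cat K ts ++ V K 0 t ++ Z) (length (cat K ts) + y) (length (cat K ts) + y′)
differs⇒block {K} {ts} {t} {y} Z d =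
  subst (Block S o) (trans (+-assoc (length (cat K ts)) y l) (cong (length (cat K ts) +_) (sym y′≡)))
    (novel⇒block S 0<l novel)
  where
  open Differs d
  S = cat K ts ++ V K 0 t ++ Z
  o = length (cat K ts) + y
  y< : y < 2 ^ K
  y< = ≤-trans (m<m+n y 0<l) y′≤
  here-y : drop o S ≡ drop y (V K 0 t ++ Z)
  here-y = drop-length-++ (cat K ts) y _
  same-label : ∀ {t′ j Z′} → j < 2 ^ K →
               take (suc l) (drop j (V K 0 t′ ++ Z′)) ≡ take (suc l) (drop y (V K 0 t ++ Z)) → j ≡ y
  same-label {t′} {j} {Z′} j< eq with V-label K 0 t′ Z′ j< | V-label K 0 t Z y<
  ... | _ , _ , eq₁ | _ , _ , eq₂ =
    cong proj₁ (∷-injectiveˡ (trans (sym (cong (take (suc l)) eq₁)) (trans eq (cong (take (suc l)) eq₂))))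
  take-suc⇒take : ∀ {X Y : List (ℕ × ℕ)} → take (suc l) X ≡ take (suc l) Y → take l X ≡ take l Y
  take-suc⇒take {X} {Y} eq = trans (shrink X) (trans (cong (take l) eq) (sym (shrink Y)))
    where
    shrink : ∀ X → take l X ≡ take l (take (suc l) X)
    shrink X = sym (trans (take-take l (suc l) X) (cong (λ h → take h X) (m≤n⇒m⊓n≡m (n≤1+n l))))
  novel : ∀ {i} → i < o → ¬ Agree S i o (suc l)
  novel {i} i<o (agrees same) with i <? length (cat K ts)
  ... | yes lt with locate K ts (V K 0 t ++ Z) lt
  ...   | t′ , j , Z′ , t′∈ , j< , eq
    with eq′ ← trans (sym (cong (take (suc l)) eq)) (trans same (cong (take (suc l)) here-y))
    with refl ← same-label {t′} {j} {Z′} j< eq′ = differs t′∈ 0 Z′ Z (take-suc⇒take eq′)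
  novel {i} i<o (agrees same) | no ge with m≤n⇒∃[o]m+o≡n (≮⇒≥ ge)
  ... | j , refl = <-irrefl (same-label {t} {j} {Z} (<-trans j<y y<)
      (trans (sym (cong (take (suc l)) (drop-length-++ (cat K ts) j _)))
        (trans same (cong (take (suc l)) here-y)))) j<y
    where
    j<y : j < y
    j<y = +-cancelˡ-< (length (cat K ts)) _ _ i<o

fresh⇒blocks : ∀ {ts} → Fresh K ts w → ∀ Z → Chain (Block (cat K ts ++ Z)) 0 (length (cat K ts)) w
fresh⇒blocks                   []                                 Z = []
fresh⇒blocks {K} (_∷_ {m = m} {w} {t} {ts} tiled fresh) Z =
  subst₂ (λ U j → Chain (Block U) 0 (length (cat K ts ++ V K 0 t)) j) (sym (++-assoc (cat K ts) (V K 0 t) Z)) (+-comm w m)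
    (fresh⇒blocks fresh (V K 0 t ++ Z) ◅◅
      subst₂ (λ s e → Chain (Block (cat K ts ++ V K 0 t ++ Z)) s e m)
        (+-identityʳ (length (cat K ts)))
        (sym (trans (length-++ (cat K ts)) (cong (length (cat K ts) +_) (length-V K 0 t))))
        (gmap (length (cat K ts) +_) (differs⇒block Z) tiled))

odd : ℕ → ℕ
odd q = suc (q + q)

-- The times t with 0 < t < 2 ^ K, those divisible by higher powers of 2 being
-- earlier in the string. At an odd time the whole block is new; at time 2 a of
-- level K + 1 both halves of the block split like the block at time a of level K.
times : ℕ → List ℕ
times zero    = []
times (suc K) = map odd (downFrom (2 ^ K)) ++ map dbl (times K)

-- This is `K * 2 ^ (K - 1)`, see `weight*2`. The summand `2 ^ K` comes from the odd times, the rest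
-- from the two halves of the words at even times.
weight : ℕ → ℕ
weight zero    = 0
weight (suc K) = 2 ^ K + (weight K + weight K)

dbl-injective : ∀ {a b} → dbl a ≡ dbl b → a ≡ b
dbl-injective {a} {b} eq = trans (n≡⌊n+n/2⌋ a) (trans (cong ⌊_/2⌋ eq) (sym (n≡⌊n+n/2⌋ b)))

odd≢dbl : ∀ {q a} → odd q ≢ dbl a
odd≢dbl {q} {a} eq = 1+n≢n (trans eq (cong dbl (trans (n≡⌊n+n/2⌋ a)
  (trans (cong ⌊_/2⌋ (sym eq)) (sym (n≡⌈n+n/2⌉ q))))))

-- Even times precede the odd ones in the string, so they are compared with even times only, and
-- `fresh-dbl` applies.
fresh-times : ∀ K → Fresh K (times K) (weight K)
fresh-times zero    = []
fresh-times (suc K) = go (2 ^ K)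
  where
  go : ∀ j → Fresh (suc K) (map odd (downFrom j) ++ map dbl (times K)) (j + (weight K + weight K))
  go zero    = fresh-dbl (fresh-times K)
  go (suc j) = tiled-whole (suc K) new ∷ go j
    where
    new : odd j ∉ map odd (downFrom j) ++ map dbl (times K)
    new j∈ with ∈-++⁻ (map odd (downFrom j)) j∈
    ... | inj₁ j∈odds with ∈-map⁻ odd j∈odds
    ...   | q , q∈ , eq = <-irrefl (sym (dbl-injective (suc-injective eq))) (∈-downFrom⁻ q∈)
    new j∈ | inj₂ j∈evens with ∈-map⁻ dbl j∈evens
    ... | a , _ , eq = odd≢dbl {j} {a} eq

weight*2 : ∀ K → weight K * 2 ≡ K * 2 ^ K
weight*2 zero    = refl
weight*2 (suc K) = trans (regroup (2 ^ K) (weight K)) (trans (cong (λ w → 2 ^ K * 2 + w * 2) (weight*2 K)) (regroup′ (2 ^ K) K))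
  where
  regroup : ∀ M w → (M + (w + w)) * 2 ≡ M * 2 + w * 2 * 2
  regroup = solve-∀
  regroup′ : ∀ M K → M * 2 + K * M * 2 ≡ suc K * (M + (M + 0))
  regroup′ = solve-∀

length-times : ∀ K → suc (length (times K)) ≡ 2 ^ K
length-times zero    = refl
length-times (suc K) = begin
  suc (length (map odd (downFrom (2 ^ K)) ++ map dbl (times K)))  ≡⟨ cong suc (length-++ (map odd (downFrom (2 ^ K)))) ⟩
  suc (length (map odd (downFrom (2 ^ K))) + length (map dbl (times K)))
    ≡⟨ cong suc (cong₂ _+_ (trans (length-map odd (downFrom (2 ^ K))) (length-downFrom (2 ^ K))) (length-map dbl (times K))) ⟩
  suc (2 ^ K + length (times K))     ≡⟨ +-suc (2 ^ K) _ ⟨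
  2 ^ K + suc (length (times K))     ≡⟨ cong (2 ^ K +_) (trans (length-times K) (sym (+-identityʳ (2 ^ K)))) ⟩
  2 ^ suc K                          ∎
  where open ≡-Reasoning

times< : ∀ K → All (_< 2 ^ K) (times K)
times< zero    = []
times< (suc K) = All.++⁺
  (All.map⁺ (All.applyDownFrom⁺₁ id (2 ^ K) λ {q} q< → subst (odd q <_) (cong (2 ^ K +_) (sym (+-identityʳ (2 ^ K))))
    (subst (_≤ 2 ^ K + 2 ^ K) (cong suc (+-suc q q)) (+-mono-≤ q< q<))))
  (All.map⁺ (All.map (λ {a} a< → subst (dbl a <_) (cong (2 ^ K +_) (sym (+-identityʳ (2 ^ K)))) (+-mono-< a< a<)) (times< K)))

-- The parse of `S T`

Occurs : List (ℕ × ℕ) → List (ℕ × ℕ) → Set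
Occurs P Y = ∃₂ λ u v → P ≡ u ++ Y ++ v

occurs-++ : ∀ {P Y} Q → Occurs P Y → Occurs (P ++ Q) Y
occurs-++ {Y = Y} Q (u , v , refl) = u , v ++ Q , trans (++-assoc u (Y ++ v) Q) (cong (u ++_) (++-assoc Y v Q))

module _ (K : ℕ) (P : List (ℕ × ℕ)) where

  history : ℕ → List (ℕ × ℕ)
  history j = catFrom K P (downFrom j)

  -- The `2 ^ K` literals spell `V 0`, and each of the `j` later words costs the three phrases of
  -- `built-replace`.
  built-history : Built P m → ∀ j → Built (history (suc j)) (j * 3 + (2 ^ K + m))
  built-history {m} built zero    = subst (λ l → Built (P ++ V K 0 0) (l + m)) (length-V K 0 0) (built-literals (V K 0 0) built)
  built-history {m} built (suc j) with V-replaced K 0 j | built-history built j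
  ... | replaced {u} {v} {_} {c} X≡ Y≡ | built′ =
    subst₂ (λ X Y → Built ((history j ++ X) ++ Y) (suc j * 3 + (2 ^ K + m))) (sym X≡) (sym Y≡)
      (built-replace (history j) u c v (subst (λ X → Built (history j ++ X) (j * 3 + (2 ^ K + m))) X≡ built′))

  history-occurs : ∀ {j t} → t < j → Occurs (history j) (V K 0 t)
  history-occurs {suc j} {t} t<1+j with m≤n⇒m<n∨m≡n (≤-pred t<1+j)
  ... | inj₁ t<j  = occurs-++ (V K 0 j) (history-occurs t<j)
  ... | inj₂ refl = history j , [] , cong (history j ++_) (sym (++-identityʳ (V K 0 j)))

  built-cat : ∀ {S ts} → All (λ t → Occurs S (V K 0 t)) ts → Built S m → Built (catFrom K S ts) (length ts + m)
  built-cat                     []         built = built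
  built-cat {S = S} {t ∷ ts} (o ∷ os) built with occurs-catFrom o ts
    where
    occurs-catFrom : ∀ {Y} → Occurs S Y → ∀ ts → Occurs (catFrom K S ts) Y
    occurs-catFrom o []       = o
    occurs-catFrom o (t ∷ ts) = occurs-++ (V K 0 t) (occurs-catFrom o ts)
  ... | u , v , eq = built-copy u (V K 0 t) v eq u< (built-cat os built)
    where
    u< : length u < length (catFrom K S ts)
    u< = subst (length u <_) (sym (trans (cong length eq) (trans (length-++ u) (cong (length u +_) (length-++ (V K 0 t))))))
      (m<m+n (length u) (≤-trans (subst (0 <_) (sym (length-V K 0 t)) (m^n>0 2 K)) (m≤m+n _ (length v))))

rotation-lower : ∀ (_≟_ : DecidableEquality (ℕ × ℕ)) K n → 2 * (2 ^ K * 2 ^ K) ≤ n →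
                 ∃₂ λ S T → length (S ++ T) ≡ n × z _≟_ (S ++ T) ≤ 5 * 2 ^ K × K * 2 ^ K ≤ 2 * z _≟_ (T ++ S)
rotation-lower _≟_ K n n≥ = S , T , len , upper , lower
  where
  open ≤-Reasoning
  M = 2 ^ K
  ts = times K
  h = length ts
  -- There are `M = suc h` words in `S` and `h` in `T`: in all `2M² - M` letters, which leaves room
  -- for a nonempty `pad`.
  L = suc h * M + h * M
  L<n : L < n
  L<n = ≤-trans (subst (λ M → suc h * M + h * M < 2 * (M * M)) (length-times K) (below h)) n≥
    where
    regroup : ∀ h → suc (suc h * suc h + h * suc h) + h ≡ 2 * (suc h * suc h)
    regroup = solve-∀
    below : ∀ h → suc h * suc h + h * suc h < 2 * (suc h * suc h)
    below h = subst (suc (suc h * suc h + h * suc h) ≤_) (regroup h) (m≤m+n _ h)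
  r = n ∸ suc L
  -- Standing at the start of `S`, the padding follows `T` in `T S` and leaves the blocks of `T`
  -- intact.
  pad = replicate (suc r) (0 , 0)
  S = history K pad (suc h)
  T = cat K ts
  len : length (S ++ T) ≡ n
  len = begin-equality
    length (S ++ T)                 ≡⟨ cong length (catFrom-++ K S ts) ⟨
    length (catFrom K S ts)         ≡⟨ length-catFrom K S ts ⟩
    length S + h * M                ≡⟨ cong (_+ h * M) (length-catFrom K pad (downFrom (suc h))) ⟩
    length pad + length (downFrom (suc h)) * M + h * M
      ≡⟨ cong₂ (λ p d → p + d * M + h * M) (length-replicate (suc r)) (length-downFrom (suc h)) ⟩
    suc r + suc h * M + h * M       ≡⟨ regroup r (suc h * M) (h * M) ⟩
    suc L + r                       ≡⟨ m+[n∸m]≡n L<n ⟩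
    n                               ∎
    where
    regroup : ∀ r x y → suc r + x + y ≡ suc (x + y) + r
    regroup = solve-∀
  built : Built (catFrom K S ts) (h + (h * 3 + (M + 2)))
  built = built-cat K pad (All.map (λ {t} t< → history-occurs K pad (subst (t <_) (sym (length-times K)) t<)) (times< K))
    (built-history K pad (built-replicate r (0 , 0)) h)
  parse : Chain (Step (S ++ T)) 0 (length (S ++ T)) (h + (h * 3 + (M + 2)))
  parse = subst (λ U → Chain (Step U) 0 (length U) (h + (h * 3 + (M + 2)))) (catFrom-++ K S ts)
    (subst (λ U → Chain (Step U) 0 (length (catFrom K S ts)) (h + (h * 3 + (M + 2)))) (++-identityʳ _) (built []))
  upper : z _≟_ (S ++ T) ≤ 5 * M
  upper = begin
    z _≟_ (S ++ T)            ≤⟨ blocks≤steps (lz-blocks _≟_ (S ++ T)) parse ≤-refl ≤-refl ⟩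
    -- With `M = suc h` the count is `5M - 2`.
    h + (h * 3 + (M + 2))     ≤⟨ m≤m+n _ 2 ⟩
    h + (h * 3 + (M + 2)) + 2 ≡⟨ cong (λ M → h + (h * 3 + (M + 2)) + 2) (length-times K) ⟨
    h + (h * 3 + (suc h + 2)) + 2 ≡⟨ regroup h ⟩
    5 * suc h                 ≡⟨ cong (5 *_) (length-times K) ⟩
    5 * M                     ∎
    where
    regroup : ∀ h → h + (h * 3 + (suc h + 2)) + 2 ≡ 5 * suc h
    regroup = solve-∀
  lower : K * M ≤ 2 * z _≟_ (T ++ S)
  lower = begin
    K * M          ≡⟨ weight*2 K ⟨
    weight K * 2   ≡⟨ *-comm (weight K) 2 ⟩
    2 * weight K   ≤⟨ *-monoʳ-≤ 2 (blocks≤steps (fresh⇒blocks (fresh-times K) S) (lz-parse _≟_ (T ++ S)) ≤-refl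
                        (subst (length T ≤_) (sym (length-++ T)) (m≤m+n _ (length S)))) ⟩
    2 * z _≟_ (T ++ S) ∎

-- The maximum ratio

module _ {A B : Set} where

  window-map : ∀ (f : A → B) S i l → take l (drop i (map f S)) ≡ map f (take l (drop i S))
  window-map f S i l = trans (cong (take l) (drop-map i S)) (take-map l (drop i S))

  agree-map : ∀ (f : A → B) {S i j l} → Agree S i j l → Agree (map f S) i j l
  agree-map f {S} {i} {j} {l} (agrees eq) =
    agrees (trans (window-map f S i l) (trans (cong (map f) eq) (sym (window-map f S j l))))

  agree-map⁻ : ∀ {f : A → B} → (∀ {x y} → f x ≡ f y → x ≡ y) →
               ∀ {S i j l} → Agree (map f S) i j l → Agree S i j l
  agree-map⁻ {f} inj {S} {i} {j} {l} (agrees eq) =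
    agrees (map-injective inj (trans (sym (window-map f S i l)) (trans eq (window-map f S j l))))

  -- A parse of `S` carries over to `S′` phrase by phrase, and no parse of `S′` beats the greedy
  -- one.
  z-mono : ∀ (_≟A_ : DecidableEquality A) (_≟B_ : DecidableEquality B) S S′ → length S ≡ length S′ →
           (∀ {i j l} → Agree S i j l → Agree S′ i j l) → z _≟B_ S′ ≤ z _≟A_ S
  z-mono _≟A_ _≟B_ S S′ eq sub = blocks≤steps (lz-blocks _≟B_ S′) (gmap id step (lz-parse _≟A_ S)) ≤-refl (≤-reflexive (sym eq))
    where
    step : ∀ {b d} → Step S b d → Step S′ b d
    step literal        = literal
    step (copy i<b agr) = copy i<b (sub agr)

-- `f` is injective on the letters of `S`, as witnessed by the partial inverse `g`, which carries
-- agreements back.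
z-map : ∀ {A B : Set} (_≟A_ : DecidableEquality A) (_≟B_ : DecidableEquality B) (f : A → B) (g : B → Maybe A) S →
        All (λ a → g (f a) ≡ just a) S → z _≟B_ (map f S) ≡ z _≟A_ S
z-map _≟A_ _≟B_ f g S inverse = ≤-antisym
  (z-mono _≟A_ _≟B_ S (map f S) (sym (length-map f S)) (agree-map f))
  (z-mono _≟B_ _≟A_ (map f S) S (length-map f S) λ agr →
    agree-map⁻ just-injective (subst (λ X → Agree X _ _ _) decode (agree-map g agr)))
  where
  decode : map g (map f S) ≡ map just S
  decode = trans (sym (map-∘ S)) (map-cong-local inverse)

-- Renaming letters to numbers, and the maximum over a finite list

module _ {A : Set} (_≟_ : DecidableEquality A) where

  -- The index of the first occurrence; an absent letter gets `length X`, so all codes are below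
  -- `suc (length X)`.
  code : List A → A → ℕ
  code []      a = 0
  code (x ∷ X) a with x ≟ a
  ... | yes _ = 0
  ... | no  _ = suc (code X a)

  code≤length : ∀ X a → code X a ≤ length X
  code≤length []      a = z≤n
  code≤length (x ∷ X) a with x ≟ a
  ... | yes _ = z≤n
  ... | no  _ = s≤s (code≤length X a)

  letter : List A → ℕ → Maybe A
  letter []      i       = nothing
  letter (x ∷ X) zero    = just x
  letter (x ∷ X) (suc i) = letter X i

  letter-code : ∀ {X a} → a ∈ X → letter X (code X a) ≡ just a
  letter-code {x ∷ X} {a} a∈ with x ≟ a
  ... | yes refl = refl
  letter-code {x ∷ X} {a} (here refl) | no x≢a = ⊥-elim (x≢a refl)
  letter-code {x ∷ X} {a} (there a∈)  | no x≢a = letter-code a∈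

words : ℕ → ℕ → List (List ℕ)
words k zero    = [ [] ]
words k (suc n) = cartesianProductWith _∷_ (upTo k) (words k n)

∈-words : ∀ {k} X → All (_< k) X → X ∈ words k (length X)
∈-words []      []       = here refl
∈-words (x ∷ X) (x< ∷ X<) = ∈-cartesianProductWith⁺ _∷_ (∈-upTo⁺ x<) (∈-words X X<)

length-words : ∀ {k} n {X} → X ∈ words k n → length X ≡ n
length-words zero    (here refl) = refl
length-words {k} (suc n) X∈ with ∈-cartesianProductWith⁻ _∷_ (upTo k) (words k n) X∈
... | _ , _ , _ , Y∈ , refl = cong suc (length-words n Y∈)

-- The value for denominator 0 is irrelevant.
frac : ℕ → ℕ → ℚ
frac a zero    = 0ℚ
frac a (suc b) = ℤ.+ a ÷ suc b

frac-÷ : ∀ a b .{{_ : NonZero b}} → frac a b ≡ ℤ.+ a ÷ b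
frac-÷ a (suc b) = refl

rotation : List ℕ × ℕ → ℚ
rotation (X , i) = frac (z _≟_ (drop i X ++ take i X)) (z _≟_ (take i X ++ drop i X))

-- Up to renaming, the letters of a string of length `n` are numbers up to `n`, so finitely many
-- candidates realize every ratio and a maximum exists.
rotations : ℕ → List (List ℕ × ℕ)
rotations n = cartesianProduct (words (suc n) n) (upTo (suc n))

-- The default of `argmax` has length `n` too, so the maximizer is always a string of length `n`.
best : ℕ → List ℕ × ℕ
best n = argmax rotation (replicate n 0 , 0) (rotations n)

Rot : ℕ → ℚ
Rot n = rotation (best n)

length-best : ∀ n → length (proj₁ (best n)) ≡ n
length-best n = argmax-all rotation {P = λ p → length (proj₁ p) ≡ n} (length-replicate n) (All.tabulate valid)
  where
  valid : ∀ {p} → p ∈ rotations n → length (proj₁ p) ≡ n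
  valid p∈ = length-words n (proj₁ (∈-cartesianProduct⁻ (words (suc n) n) (upTo (suc n)) p∈))

-- `code` renames the letters injectively, `z-map` preserves both phrase counts, and the renamed
-- pair is in `rotations n`.
rotation≤Rot : ∀ {A : Set} (_≟A_ : DecidableEquality A) (S T : List A) →
               frac (z _≟A_ (T ++ S)) (z _≟A_ (S ++ T)) ℚ.≤ Rot (length (S ++ T))
rotation≤Rot _≟A_ S T = subst (ℚ._≤ Rot n) value
  (All.lookup (f[xs]≤f[argmax] {f = rotation} (replicate n 0 , 0) (rotations n)) member)
  where
  n = length (S ++ T)
  i = length S
  enc = code _≟A_ (S ++ T)
  dec = letter _≟A_ (S ++ T)
  X = map enc (S ++ T)
  inverse : All (λ a → dec (enc a) ≡ just a) (S ++ T)
  inverse = All.tabulate (letter-code _≟A_)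
  member : (X , i) ∈ rotations n
  member = ∈-cartesianProduct⁺
    (subst (λ l → X ∈ words (suc n) l) (length-map enc (S ++ T))
      (∈-words X (All.map⁺ (All.tabulate λ {a} _ → s≤s (code≤length _≟A_ (S ++ T) a)))))
    (∈-upTo⁺ (s≤s (subst (i ≤_) (sym (length-++ S)) (m≤m+n i (length T)))))
  X≡ : X ≡ map enc S ++ map enc T
  X≡ = map-++ enc S T
  take≡ : take i X ≡ map enc S
  take≡ = subst₂ (λ i X → take i X ≡ map enc S) (length-map enc S) (sym X≡) (take-length-++ (map enc S) (map enc T))
  drop≡ : drop i X ≡ map enc T
  drop≡ = trans (drop-map i (S ++ T)) (cong (map enc) (subst (λ i → drop i (S ++ T) ≡ T) (+-identityʳ i) (drop-length-++ S 0 T)))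
  value : rotation (X , i) ≡ frac (z _≟A_ (T ++ S)) (z _≟A_ (S ++ T))
  value = cong₂ frac
    (trans (cong₂ (λ U V → z _≟_ (U ++ V)) drop≡ take≡) (trans (cong (z _≟_) (sym (map-++ enc T S)))
      (z-map _≟A_ _≟_ enc dec (T ++ S) (All.++⁺ (All.++⁻ʳ S inverse) (All.++⁻ˡ S inverse)))))
    (trans (cong (z _≟_) (take++drop≡id i X)) (z-map _≟A_ _≟_ enc dec (S ++ T) inverse))

isRot : IsRot Rot
isRot n = attained , bound
  where
  X = proj₁ (best n)
  i = proj₂ (best n)
  len : length (take i X ++ drop i X) ≡ n
  len = trans (cong length (take++drop≡id i X)) (length-best n)
  attained : RotationRatio n (Rot n)
  attained = subst (RotationRatio n) (sym (frac-÷ p q)) (ratio _≟_ (take i X) (drop i X) len)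
    where
    p = z _≟_ (drop i X ++ take i X)
    q = z _≟_ (take i X ++ drop i X)
    instance
      q≢0 : NonZero q
      q≢0 = z-nonZero _≟_ (take i X ++ drop i X) (subst (0 <_) (sym len) (>-nonZero⁻¹ n))
  bound : ∀ q → RotationRatio n q → q ℚ.≤ Rot n
  bound _ (ratio _≟A_ S T refl) = subst (ℚ._≤ Rot (length (S ++ T))) (frac-÷ (z _≟A_ (T ++ S)) (z _≟A_ (S ++ T))) (rotation≤Rot _≟A_ S T)

-- Fractions and the binary logarithm

÷-mono-≤ : ∀ a b c d .{{_ : NonZero b}} .{{_ : NonZero d}} → a * d ≤ c * b → ℤ.+ a ÷ b ℚ.≤ ℤ.+ c ÷ d
÷-mono-≤ a (suc b) c (suc d) le = ℚ.toℚᵘ-cancel-≤ (begin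
  toℚᵘ (ℤ.+ a ÷ suc b) ≃⟨ ℚ.toℚᵘ-fromℚᵘ (mkℚᵘ (ℤ.+ a) b) ⟩
  mkℚᵘ (ℤ.+ a) b       ≤⟨ ℚᵘ.*≤* (subst₂ ℤ._≤_ (ℤ.pos-* a (suc d)) (ℤ.pos-* c (suc b)) (ℤ.+≤+ le)) ⟩
  mkℚᵘ (ℤ.+ c) d       ≃⟨ ℚ.toℚᵘ-fromℚᵘ (mkℚᵘ (ℤ.+ c) d) ⟨
  toℚᵘ (ℤ.+ c ÷ suc d) ∎)
  where open ℚᵘ.≤-Reasoning

÷-*-÷1 : ∀ a b c .{{_ : NonZero b}} → (ℤ.+ a ÷ b) ℚ.* (ℤ.+ c ÷ 1) ≡ ℤ.+ (a * c) ÷ b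
÷-*-÷1 a (suc b) c = ℚ.toℚᵘ-injective (begin-equality
  toℚᵘ ((ℤ.+ a ÷ suc b) ℚ.* (ℤ.+ c ÷ 1))       ≃⟨ ℚ.toℚᵘ-homo-* (ℤ.+ a ÷ suc b) (ℤ.+ c ÷ 1) ⟩
  toℚᵘ (ℤ.+ a ÷ suc b) ℚᵘ.* toℚᵘ (ℤ.+ c ÷ 1)   ≃⟨ ℚᵘ.*-cong (ℚ.toℚᵘ-fromℚᵘ (mkℚᵘ (ℤ.+ a) b)) (ℚ.toℚᵘ-fromℚᵘ (mkℚᵘ (ℤ.+ c) 0)) ⟩
  mkℚᵘ (ℤ.+ a) b ℚᵘ.* mkℚᵘ (ℤ.+ c) 0           ≃⟨ ℚᵘ.*≡* (cong₂ ℤ._*_ (sym (ℤ.pos-* a c)) (cong (λ d → ℤ.+ suc d) (sym (*-identityʳ b)))) ⟩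
  mkℚᵘ (ℤ.+ (a * c)) b                       ≃⟨ ℚ.toℚᵘ-fromℚᵘ (mkℚᵘ (ℤ.+ (a * c)) b) ⟨
  toℚᵘ (ℤ.+ (a * c) ÷ suc b)                 ∎)
  where open ℚᵘ.≤-Reasoning

n<2^[1+⌊log₂n⌋] : ∀ n → n < 2 ^ suc ⌊log₂ n ⌋
n<2^[1+⌊log₂n⌋] n with n <? 2 ^ suc ⌊log₂ n ⌋
... | yes lt = lt
... | no  ge = ⊥-elim (1+n≰n (subst (_≤ ⌊log₂ n ⌋) (⌊log₂[2^n]⌋≡n (suc ⌊log₂ n ⌋)) (⌊log₂⌋-mono-≤ (≮⇒≥ ge))))

2^⌊log₂n⌋≤n : ∀ n .{{_ : NonZero n}} → 2 ^ ⌊log₂ n ⌋ ≤ n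
2^⌊log₂n⌋≤n n = <-rec (λ n → 0 < n → 2 ^ ⌊log₂ n ⌋ ≤ n) go n (>-nonZero⁻¹ n)
  where
  open ≤-Reasoning
  go : ∀ n → (∀ {k} → k < n → 0 < k → 2 ^ ⌊log₂ k ⌋ ≤ k) → 0 < n → 2 ^ ⌊log₂ n ⌋ ≤ n
  go 1              rec _ = ≤-refl
  go n@(suc (suc k)) rec _ = begin
    2 ^ ⌊log₂ n ⌋                     ≤⟨ ^-monoʳ-≤ 2 (m≤n+m∸n ⌊log₂ n ⌋ 1) ⟩
    2 ^ suc (⌊log₂ n ⌋ ∸ 1)           ≡⟨ cong (λ l → 2 ^ suc l) (⌊log₂⌊n/2⌋⌋≡⌊log₂n⌋∸1 n) ⟨
    2 * 2 ^ ⌊log₂ ⌊ n /2⌋ ⌋           ≤⟨ *-monoʳ-≤ 2 (rec (⌊n/2⌋<n (suc k)) (s≤s z≤n)) ⟩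
    2 * ⌊ n /2⌋                       ≡⟨ cong (λ h → ⌊ n /2⌋ + h) (+-identityʳ ⌊ n /2⌋) ⟩
    ⌊ n /2⌋ + ⌊ n /2⌋                 ≤⟨ +-monoʳ-≤ ⌊ n /2⌋ (⌊n/2⌋≤⌈n/2⌉ n) ⟩
    ⌊ n /2⌋ + ⌈ n /2⌉                 ≡⟨ ⌊n/2⌋+⌈n/2⌉≡n n ⟩
    n                                 ∎

-- The explicit constants

module _ (n : ℕ) (8≤n : 8 ≤ n) where

  private
    l = ⌊log₂ n ⌋
    instance
      n≢0 : NonZero n
      n≢0 = >-nonZero (≤-trans (s≤s z≤n) 8≤n)
    3≤l : 3 ≤ l
    3≤l = ⌊log₂⌋-mono-≤ 8≤n

  ratio≤ : ∀ {r} → RotationRatio n r → r ℚ.≤ (ℤ.+ 14 ÷ 1) ℚ.* log n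
  ratio≤ (ratio _≟A_ S T len) = subst (_ ℚ.≤_) (sym (÷-*-÷1 14 1 l)) (÷-mono-≤ p q (14 * l) 1 (begin
    p * 1                    ≡⟨ *-identityʳ p ⟩
    p                        ≤⟨ rotation-upper _≟A_ S T (suc l) TS< (subst (0 <_) (sym len) (>-nonZero⁻¹ n)) ⟩
    -- Here `1 + l ≤ 2l` and `3q + 4 ≤ 7q`, hence the constant 14.
    suc l * suc (suc q * 3)  ≤⟨ *-mono-≤ (+-monoˡ-≤ l (≤-trans (s≤s z≤n) 3≤l)) (≤-trans (≤-reflexive (regroup₁ q)) (+-monoʳ-≤ (3 * q) (*-monoʳ-≤ 4 (>-nonZero⁻¹ q)))) ⟩
    (l + l) * (3 * q + 4 * q) ≡⟨ regroup₂ l q ⟩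
    14 * l * q               ∎))
    where
    open ≤-Reasoning
    p = z _≟A_ (T ++ S)
    q = z _≟A_ (S ++ T)
    TS< : length (T ++ S) < 2 ^ suc l
    TS< = subst (_< 2 ^ suc l) (sym (trans (length-++-comm T S) len)) (n<2^[1+⌊log₂n⌋] n)
    regroup₁ : ∀ q → suc (suc q * 3) ≡ 3 * q + 4
    regroup₁ = solve-∀
    regroup₂ : ∀ l q → (l + l) * (3 * q + 4 * q) ≡ 14 * l * q
    regroup₂ = solve-∀

  ≤ratio : ∃ λ r → RotationRatio n r × (ℤ.+ 1 ÷ 40) ℚ.* log n ℚ.≤ r
  ≤ratio = from (rotation-lower _≟′_ h n big)
    where
    open ≤-Reasoning
    _≟′_ = ≡-dec _≟_ _≟_
    -- The largest `h` with `2h + 1 ≤ l`, so that `2 * 4 ^ h ≤ 2 ^ l ≤ n`. It is positive because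
    -- `8 ≤ n` gives `3 ≤ l`.
    h = ⌊ l ∸ 1 /2⌋
    M = 2 ^ h
    1+[l∸1] : suc (l ∸ 1) ≡ l
    1+[l∸1] = m+[n∸m]≡n (≤-trans (s≤s z≤n) 3≤l)
    1+2h≤l : suc (h + h) ≤ l
    1+2h≤l = subst (suc (h + h) ≤_) (trans (cong suc (⌊n/2⌋+⌈n/2⌉≡n (l ∸ 1))) 1+[l∸1])
      (s≤s (+-monoʳ-≤ h (⌊n/2⌋≤⌈n/2⌉ (l ∸ 1))))
    big : 2 * (M * M) ≤ n
    big = begin
      2 * (M * M)  ≡⟨ cong (2 *_) (^-distribˡ-+-* 2 h h) ⟨
      2 ^ suc (h + h)  ≤⟨ ^-monoʳ-≤ 2 1+2h≤l ⟩
      2 ^ l  ≤⟨ 2^⌊log₂n⌋≤n n ⟩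
      n                  ∎
    1≤h : 1 ≤ h
    1≤h = ⌊n/2⌋-mono (∸-monoˡ-≤ 1 3≤l)
    ⌈n/2⌉≤1+⌊n/2⌋ : ∀ n → ⌈ n /2⌉ ≤ suc ⌊ n /2⌋
    ⌈n/2⌉≤1+⌊n/2⌋ n with ⌈n/2⌉≡⌊n/2⌋⊎suc n
    ... | inj₁ eq = ≤-trans (≤-reflexive eq) (n≤1+n _)
    ... | inj₂ eq = ≤-reflexive eq
    l≤4h : l ≤ 4 * h
    l≤4h = begin
      l  ≡⟨ 1+[l∸1] ⟨
      suc (l ∸ 1)  ≡⟨ cong suc (⌊n/2⌋+⌈n/2⌉≡n (l ∸ 1)) ⟨
      suc (h + ⌈ l ∸ 1 /2⌉)  ≤⟨ s≤s (+-monoʳ-≤ h (⌈n/2⌉≤1+⌊n/2⌋ (l ∸ 1))) ⟩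
      suc (h + suc h)  ≡⟨ regroup h ⟩
      2 * 1 + 2 * h  ≤⟨ +-monoˡ-≤ (2 * h) (*-monoʳ-≤ 2 1≤h) ⟩
      2 * h + 2 * h  ≡⟨ *-distribʳ-+ h 2 2 ⟨
      4 * h                        ∎
      where
      regroup : ∀ h → suc (h + suc h) ≡ 2 * 1 + 2 * h
      regroup = solve-∀
    from : (∃₂ λ S T → length (S ++ T) ≡ n × z _≟′_ (S ++ T) ≤ 5 * M × h * M ≤ 2 * z _≟′_ (T ++ S)) →
           ∃ λ r → RotationRatio n r × (ℤ.+ 1 ÷ 40) ℚ.* log n ℚ.≤ r
    -- The constant: `p / q ≥ (h M / 2) / (5 M) = h / 10 ≥ l / 40`.
    from (S , T , len , ST≤ , TS≥) = ℤ.+ p ÷ q , ratio _≟′_ S T len ,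
      subst (ℚ._≤ (ℤ.+ p ÷ q)) (sym (÷-*-÷1 1 40 l)) (÷-mono-≤ (1 * l) 40 p q (begin
        1 * l * q  ≡⟨ cong (_* q) (*-identityˡ l) ⟩
        l * q  ≤⟨ *-mono-≤ l≤4h ST≤ ⟩
        4 * h * (5 * M)  ≡⟨ regroup₁ h M ⟩
        20 * (h * M)  ≤⟨ *-monoʳ-≤ 20 TS≥ ⟩
        20 * (2 * p)  ≡⟨ regroup₂ p ⟩
        p * 40               ∎))
      where
      p = z _≟′_ (T ++ S)
      q = z _≟′_ (S ++ T)
      instance
        q≢0 : NonZero q
        q≢0 = z-nonZero _≟′_ (S ++ T) (subst (0 <_) (sym len) (>-nonZero⁻¹ n))
      regroup₁ : ∀ h M → 4 * h * (5 * M) ≡ 20 * (h * M)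
      regroup₁ = solve-∀
      regroup₂ : ∀ p → 20 * (2 * p) ≡ p * 40
      regroup₂ = solve-∀

corollary9 : Σ[ Rot ∈ (ℕ → ℚ) ] (IsRot Rot × Rot ∈Θ log)
corollary9 = Rot , isRot , ℤ.+ 1 ÷ 40 , ℤ.+ 14 ÷ 1 , ℚ.positive⁻¹ (ℤ.+ 1 ÷ 40) , ℚ.positive⁻¹ (ℤ.+ 14 ÷ 1) , 8 , bounds
  where
  bounds : ∀ n → 8 ≤ n → (ℤ.+ 1 ÷ 40) ℚ.* log n ℚ.≤ Rot n × Rot n ℚ.≤ (ℤ.+ 14 ÷ 1) ℚ.* log n
  bounds n@(suc _) 8≤n = ℚ.≤-trans q≥ (proj₂ (isRot n) q rq) , ratio≤ n 8≤n (proj₁ (isRot n))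
    where
    q  = proj₁ (≤ratio n 8≤n)
    rq = proj₁ (proj₂ (≤ratio n 8≤n))
    q≥ = proj₂ (proj₂ (≤ratio n 8≤n))
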